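{- Let $G$ be a connected 4-regular graph. Let $v$ and $w$ be adjacent vertices of $G$ which have no common neighbours. Then \[ c_2^{(2)}(G - v) = c_2^{(2)}(G - w). \]
   Context: For a graph $H$, $H-v$ denotes the graph obtained by deleting the vertex $v$ and all edges incident to it. For a connected graph $H$ with at least $3$ vertices, assign a variable $\alpha_e$ to each edge $e$ and define $\Psi_H=\sum_{T}\prod_{e\notin T}\alpha_e$, the sum over all spanning trees $T$ of $H$. For a prime $p$, let $[\Psi_H]_p$ be the number of zeros of $\Psi_H$ in $\mathbb{F}_p^{|E(H)|}$; it is divisible by $p^2$, and $c_2^{(p)}(H)\equiv [\Psi_H]_p/p^2 \pmod p$. -}

module Defs where

open import Data.Bool using (Bool; true; false; _∧_; _∨_; not; if_then_else_)
open import Data.Nat using (ℕ; zero; suc; _+_; _*_; _∸_; _/_; _%_; _≡ᵇ_; _<ᵇ_)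
open import Data.Fin using (Fin; toℕ)
open import Data.Fin.Properties using (_≟_)
open import Data.List using (List; []; _∷_; length; map; filter; allFin; upTo; concatMap)
open import Data.Bool.ListAction using (any; all)
open import Data.Nat.ListAction using (sum; product)
open import Data.Product using (_×_; _,_; proj₁; proj₂)
open import Relation.Nullary.Decidable using (⌊_⌋)
open import Relation.Binary.PropositionalEquality using (_≡_)
open import Relation.Unary using (Pred)

record Graph (n : ℕ) : Set where
  field
    adj    : Fin n → Fin n → Bool
    sym    : ∀ i j → adj i j ≡ adj j i
    irrefl : ∀ i → adj i i ≡ false
open Graph public

degree : ∀ {n} → Graph n → Fin n → ℕ
degree G v = length (filter (λ j → adj G v j Data.Bool.≟ true) (allFin _))

FourRegular : ∀ {n} → Graph n → Set
FourRegular G = ∀ v → degree G v ≡ 4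

_==_ : ∀ {n} → Fin n → Fin n → Bool
i == j = ⌊ i ≟ j ⌋

-- A graph given by an explicit vertex list and an explicit edge list
-- (each edge an (unordered) pair of distinct vertices).
record SubGraph (n : ℕ) : Set where
  field
    verts : List (Fin n)
    edges : List (Fin n × Fin n)
open SubGraph public

adjIn : ∀ {n} → List (Fin n × Fin n) → Fin n → Fin n → Bool
adjIn E x y = any (λ e → (proj₁ e == x ∧ proj₂ e == y) ∨ (proj₁ e == y ∧ proj₂ e == x)) E

reach : ∀ {n} → List (Fin n) → List (Fin n × Fin n) → ℕ → Fin n → Fin n → Bool
reach V E zero    u y = u == y
reach V E (suc k) u y = reach V E k u y ∨ any (λ x → reach V E k u x ∧ adjIn E x y) V

connectedB : ∀ {n} → List (Fin n) → List (Fin n × Fin n) → Bool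
connectedB V E = all (λ u → all (λ y → reach V E (length V) u y) V) V

edgesOf : ∀ {n} → Graph n → List (Fin n × Fin n)
edgesOf {n} G = filter (λ e → ((toℕ (proj₁ e) <ᵇ toℕ (proj₂ e)) ∧ adj G (proj₁ e) (proj₂ e)) Data.Bool.≟ true)
                       (concatMap (λ i → map (λ j → (i , j)) (allFin n)) (allFin n))

asSub : ∀ {n} → Graph n → SubGraph n
asSub {n} G = record { verts = allFin n ; edges = edgesOf G }

Connected : ∀ {n} → Graph n → Set
Connected G = connectedB (verts (asSub G)) (edges (asSub G)) ≡ true

delete : ∀ {n} → Graph n → Fin n → SubGraph n
delete {n} G v = record
  { verts = filter (λ u → not (u == v) Data.Bool.≟ true) (allFin n)
  ; edges = filter (λ e → not (proj₁ e == v ∨ proj₂ e == v) Data.Bool.≟ true) (edgesOf G) }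

-- all Boolean masks of length m (subsets of an m-element edge list)
masks : ℕ → List (List Bool)
masks zero    = [] ∷ []
masks (suc m) = concatMap (λ s → (false ∷ s) ∷ (true ∷ s) ∷ []) (masks m)

-- all vectors of length m with entries in {0, …, p-1}  (= F_p^m)
points : ℕ → ℕ → List (List ℕ)
points p zero    = [] ∷ []
points p (suc m) = concatMap (λ a → map (λ x → x ∷ a) (upTo p)) (points p m)

select : ∀ {A : Set} → List Bool → List A → List A
select (true  ∷ bs) (x ∷ xs) = x ∷ select bs xs
select (false ∷ bs) (x ∷ xs) = select bs xs
select _ _ = []

countTrue : List Bool → ℕ
countTrue bs = length (filter (λ b → b Data.Bool.≟ true) bs)

isSpanningTree : ∀ {n} → SubGraph n → List Bool → Bool
isSpanningTree H T =
  (countTrue T ≡ᵇ (length (verts H) ∸ 1)) ∧ connectedB (verts H) (select T (edges H))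

prodOutside : List Bool → List ℕ → ℕ
prodOutside T α = product (select (map not T) α)

-- value of the Kirchhoff polynomial Ψ_H at the point α (computed in ℕ)
Ψ : ∀ {n} → SubGraph n → List ℕ → ℕ
Ψ H α = sum (map (λ T → if isSpanningTree H T then prodOutside T α else 0)
                 (masks (length (edges H))))

zeroCount : ∀ {n} → ℕ → SubGraph n → ℕ
zeroCount zero    H = 0
zeroCount (suc k) H =
  length (filter (λ α → (Ψ H α % suc k) Data.Nat.≟ 0) (points (suc k) (length (edges H))))

c2 : ∀ {n} → ℕ → SubGraph n → ℕ
c2 zero    H = 0
c2 (suc k) H = (zeroCount (suc k) H / (suc k * suc k)) % suc k

{-# OPTIONS --safe #-}
module Submission where

-- For a multigraph H let τ(H) be the number of ordered partitions of its edges into two spanning trees.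
--
-- (1) c₂⁽²⁾(G − v) ≡ τ(G − v) / 4 mod 2.  Let w have the neighbours x, y, z in G − v, and K = G − v − w.
-- For a fixed point of F₂^E(K), Ψ is a polynomial in the three variables at w whose coefficients are spanning
-- forest polynomials of K, and the number of its zeros in F₂³ is 4 times a number whose parity is
-- f ∨ f_xy ∨ f_xz, where f counts spanning trees of K and f_xy those of K ∪ xy containing xy.  By Jacobi's
-- identity this is a polynomial f + q + f q, where q counts the spanning forests with two components that
-- separate {x, y, z}; since deg (f q) = |E(K)|, summing over F₂^E(K) extracts the number of partitions of
-- E(K) into a spanning tree and such a forest, which is τ(G − v) / 4.
--
-- (2) τ(G − v) = τ(G − w) for all 4-regular multigraphs.  If u ≠ v, w is a vertex without loops, then τ(G − v)
-- is the sum of τ(G′ − v) over the three graphs G′ obtained from G by deleting u and joining its four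
-- neighbours in pairs.  This removes all vertices but v and w, and the resulting multigraph on {v, w} is symmetric.

open import Defs hiding (sym)
open import Data.Bool using (Bool; true; false; _∧_; _∨_; _xor_; not; if_then_else_)
open import Data.Bool.Properties using (∧-zeroʳ; not-distribˡ-xor; xor-assoc; xor-comm; xor-identityʳ; xor-same; ∧-distribˡ-xor; ∧-distribʳ-xor; xor-∧-commutativeRing; not-involutive; ∨-comm; ∨-zeroʳ; ∨-conicalˡ; ∨-conicalʳ; T-≡)
open import Data.Nat using (ℕ; zero; suc; _+_; _*_; _≤_; _<_; z≤n; s≤s; _/_; _%_; _≤?_; _∸_; _<ᵇ_; _≡ᵇ_)
open import Data.Nat.Properties as ℕ using (≤-trans; n≤1+n; 1+n≰n; suc-injective; +-suc; +-comm; ≤-reflexive; +-0-isCommutativeMonoid; *-zeroʳ; *-distribˡ-+; +-identityʳ; *-distribʳ-+; *-identityˡ; *-identityʳ; *-comm; *-assoc; ≡ᵇ⇒≡; ≡⇒≡ᵇ; <⇒<ᵇ; <ᵇ⇒<)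
open import Data.Fin using (Fin; zero; suc; punchIn; toℕ)
open import Data.Fin.Properties as Fin using (_≟_; punchInᵢ≢i; punchIn-injective; all?; pigeonhole; <-cmp)
open import Data.List using (List; []; _∷_; _++_; map; length; lookup; filter; allFin; concatMap; tabulate)
open import Data.List.Properties using (++-identityʳ; length-map; map-++; map-∘; map-cong; map-id; map-tabulate; length-tabulate; filter-notAll)
open import Data.List.Relation.Unary.All as All using (All; []; _∷_)
open import Data.List.Relation.Unary.All.Properties using (map⁺; map⁻; all-filter)
open import Data.Product using (_×_; _,_; proj₁; proj₂; ∃)
open import Data.Sum using (_⊎_; inj₁; inj₂)
open import Data.Empty using (⊥; ⊥-elim)
open import Function using (_∘_; id; flip; Equivalence)
open import Relation.Nullary using (¬_; Dec; yes; no; contradiction; does)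
open import Relation.Binary.PropositionalEquality
open import Algebra.Core using (Op₂)
open import Algebra.Structures using (IsCommutativeMonoid)
import Data.Bool as Bool
import Data.Fin as Fin
open import Relation.Nullary.Decidable using (from-yes)
open import Algebra.Bundles using (CommutativeRing)
open import Data.Nat.DivMod using ([m+n]%n≡m%n; m*n/n≡m)
open import Data.Nat.Tactic.RingSolver using (solve-∀)
import Data.Nat as ℕ using (_≟_)
open import Data.Bool.ListAction using (any; all)
open import Data.Nat.ListAction using (sum)
open import Data.Nat.ListAction.Properties using (sum-++)
open import Data.List.Membership.Propositional using (_∈_; lose)
open import Data.List.Membership.Propositional.Properties using (∈-filter⁺; ∈-filter⁻; ∈-allFin)
open import Data.List.Relation.Unary.Any using (here; there)
open import Relation.Unary using (Decidable)
open import Data.Fin.Permutation using (Permutation′; _⟨$⟩ʳ_; _⟨$⟩ˡ_; inverseˡ; inverseʳ; transpose; _∘ₚ_)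
open import Relation.Binary using (tri<; tri≈; tri>)

-- Mod 2 an edge xy is the vector e_x + e_y, and for `k` edges on `k + 1` vertices `tree` is the
-- determinant of these vectors with one coordinate dropped. Sums over splittings of an edge list
-- are then exterior products and vanish above the top degree. This takes the place of matrices in
-- Jacobi's identity, which is checked coefficient by coefficient in the edge variables. Other
-- identities fix a set of edges and vary one or two more: contracting the fixed edges leaves so few
-- vertices that a finite check suffices. Resolving a vertex of degree four works because the
-- distributions 2 + 2 of its edges to the two trees match the pairings of its neighbours term by
-- term, while the distributions 3 + 1 match only in total, by an identity for four points in a set
-- of three. Resolution creates loops even from a simple graph. A loop away from the deleted vertex
-- lies in no tree; a loop at the deleted vertex leaves too many edges for two trees. Both counts
-- are then 0, so loops end the recursion instead of disturbing it.

private variable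
  j k m n : ℕ

-- Multigraphs as lists of edges

Edge : ℕ → Set
Edge k = Fin k × Fin k

mapᵉ : (Fin j → Fin k) → Edge j → Edge k
mapᵉ f (x , y) = f x , f y

-- A ≋ B: both lists describe the same multigraph.
infix 4 _≋_
data _≋_ {k} : List (Edge k) → List (Edge k) → Set where
  nil      : [] ≋ []
  keep     : ∀ e {A B} → A ≋ B → e ∷ A ≋ e ∷ B
  turn     : ∀ x y A → (x , y) ∷ A ≋ (y , x) ∷ A
  exchange : ∀ e f A → e ∷ f ∷ A ≋ f ∷ e ∷ A
  ≋-trans  : ∀ {A B C} → A ≋ B → B ≋ C → A ≋ C

≋-refl : ∀ {A : List (Edge k)} → A ≋ A
≋-refl {A = []}    = nil
≋-refl {A = e ∷ A} = keep e ≋-refl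

≋-sym : ∀ {A B : List (Edge k)} → A ≋ B → B ≋ A
≋-sym nil              = nil
≋-sym (keep e p)       = keep e (≋-sym p)
≋-sym (turn x y A)     = turn y x A
≋-sym (exchange e f A) = exchange f e A
≋-sym (≋-trans p q)    = ≋-trans (≋-sym q) (≋-sym p)

≋-reflexive : ∀ {A B : List (Edge k)} → A ≡ B → A ≋ B
≋-reflexive refl = ≋-refl

≋-shift : ∀ (e : Edge k) A B → A ++ e ∷ B ≋ e ∷ A ++ B
≋-shift e []      B = ≋-refl
≋-shift e (f ∷ A) B = ≋-trans (keep f (≋-shift e A B)) (exchange f e (A ++ B))

≋-++ˡ : ∀ (A : List (Edge k)) {B C} → B ≋ C → A ++ B ≋ A ++ C
≋-++ˡ []      p = p
≋-++ˡ (e ∷ A) p = keep e (≋-++ˡ A p)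

≋-length : ∀ {A B : List (Edge k)} → A ≋ B → length A ≡ length B
≋-length nil              = refl
≋-length (keep e p)       = cong suc (≋-length p)
≋-length (turn x y A)     = refl
≋-length (exchange e f A) = refl
≋-length (≋-trans p q)    = trans (≋-length p) (≋-length q)

Invariant : {X : Set} → (List (Edge k) → X) → Set
Invariant p = ∀ {A B} → A ≋ B → p A ≡ p B

==-refl : (x : Fin k) → (x == x) ≡ true
==-refl x with x ≟ x
... | yes _ = refl
... | no ne = contradiction refl ne

≢⇒== : {x y : Fin k} → x ≢ y → (x == y) ≡ false
≢⇒== {x = x} {y} ne with x ≟ y
... | yes e = contradiction e ne
... | no  _ = refl

==⇒≡ : (x y : Fin k) → (x == y) ≡ true → x ≡ y
==⇒≡ x y eq with x ≟ y
... | yes e = e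

==-sym : (x y : Fin k) → (x == y) ≡ (y == x)
==-sym x y with x ≟ y
... | yes e = sym (trans (cong (y ==_) e) (==-refl y))
... | no ne = sym (≢⇒== (ne ∘ sym))

==-injective : (f : Fin j → Fin k) → (∀ {x y} → f x ≡ f y → x ≡ y) → ∀ x y → (f x == f y) ≡ (x == y)
==-injective f inj x y with x ≟ y
... | yes e = trans (cong (λ t → f x == f t) (sym e)) (==-refl (f x))
... | no ne = ≢⇒== (ne ∘ inj)

-- A total version of punchOut; the value of remove x x is junk.
remove : Fin (2 + k) → Fin (2 + k) → Fin (1 + k)
remove zero            zero    = zero
remove zero            (suc z) = z
remove (suc x)         zero    = zero
remove {zero}  (suc x) (suc z) = zero
remove {suc k} (suc x) (suc z) = suc (remove x z)

remove-punchIn : ∀ (x : Fin (2 + k)) z → remove x (punchIn x z) ≡ z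
remove-punchIn zero            z       = refl
remove-punchIn (suc x)         zero    = refl
remove-punchIn {suc k} (suc x) (suc z) = cong suc (remove-punchIn x z)

punchIn-remove : ∀ (x : Fin (2 + k)) {z} → z ≢ x → punchIn x (remove x z) ≡ z
punchIn-remove zero            {zero}  ne = contradiction refl ne
punchIn-remove zero            {suc z} ne = refl
punchIn-remove (suc x)         {zero}  ne = refl
punchIn-remove {zero} (suc zero) {suc zero} ne = contradiction refl ne
punchIn-remove {suc k} (suc x) {suc z} ne = cong suc (punchIn-remove x (ne ∘ cong suc))

-- The vertex map of contracting the edge from `x` to `y`. The number of `x` is given up, so that
-- recursion on the number of vertices is possible.
merge : Fin (2 + k) → Fin (2 + k) → Fin (2 + k) → Fin (1 + k)
merge x y z = remove x (if z == x then y else z)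

merge-self : ∀ (x y : Fin (2 + k)) → merge x y x ≡ remove x y
merge-self x y rewrite ==-refl x = refl

merge-other : ∀ (x y : Fin (2 + k)) {z} → z ≢ x → merge x y z ≡ remove x z
merge-other x y ne rewrite ≢⇒== ne = refl

merge-target : ∀ (x y : Fin (2 + k)) → merge x y y ≡ remove x y
merge-target x y with y == x
... | true  = refl
... | false = refl

merge-punchIn : ∀ (x y : Fin (2 + k)) z → merge x y (punchIn x z) ≡ z
merge-punchIn x y z = trans (merge-other x y (punchInᵢ≢i x z)) (remove-punchIn x z)

-- Spanning trees

-- Defined by successive contraction, so that contraction arguments hold by computation. The price
-- is a visible dependence on the order and orientation of the edges, which `tree-≋` repairs.
tree : ∀ k → List (Edge (suc k)) → Bool
tree zero    []            = true
tree zero    (_ ∷ _)       = false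
tree (suc k) []            = false
tree (suc k) ((x , y) ∷ A) = not (x == y) ∧ tree k (map (mapᵉ (merge x y)) A)

Potential : (Fin k → Bool) → List (Edge k) → Set
Potential s = All (λ e → s (proj₁ e) ≡ s (proj₂ e))

-- Connectivity without paths: every two-colouring that is constant along edges is constant.
-- Colourings are transported along vertex maps by composition, which suits contraction.
Conn : List (Edge k) → Set
Conn A = ∀ s → Potential s A → ∀ x y → s x ≡ s y

All-≋ : ∀ {P : Edge k → Set} → (∀ {x y} → P (x , y) → P (y , x)) → ∀ {A B} → A ≋ B → All P A → All P B
All-≋ s nil              []           = []
All-≋ s (keep e p)       (h ∷ hs)     = h ∷ All-≋ s p hs
All-≋ s (turn x y A)     (h ∷ hs)     = s h ∷ hs
All-≋ s (exchange e f A) (h ∷ g ∷ hs) = g ∷ h ∷ hs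
All-≋ s (≋-trans p q)    hs           = All-≋ s q (All-≋ s p hs)

Conn-≋ : ∀ {A B : List (Edge k)} → A ≋ B → Conn A → Conn B
Conn-≋ p c s h = c s (All-≋ sym (≋-sym p) h)

Conn-loop : ∀ {x : Fin k} {A} → Conn ((x , x) ∷ A) → Conn A
Conn-loop c s h = c s (refl ∷ h)

Conn-contract : ∀ {x y : Fin (2 + k)} {A} → x ≢ y → Conn ((x , y) ∷ A) → Conn (map (mapᵉ (merge x y)) A)
Conn-contract {x = x} {y} ne c s h p q = begin
  s p                         ≡⟨ cong s (merge-punchIn x y p) ⟨
  s (merge x y (punchIn x p)) ≡⟨ c (s ∘ merge x y) (cong s (trans (merge-self x y) (sym (merge-target x y))) ∷ map⁻ h) (punchIn x p) (punchIn x q) ⟩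
  s (merge x y (punchIn x q)) ≡⟨ cong s (merge-punchIn x y q) ⟩
  s q                         ∎
  where open ≡-Reasoning

-- A colouring of the larger graph agrees at `x` and `y`, hence factors through `merge x y`.
Conn-uncontract : ∀ {x y : Fin (2 + k)} {A} → x ≢ y → Conn (map (mapᵉ (merge x y)) A) → Conn ((x , y) ∷ A)
Conn-uncontract {x = x} {y} ne c s (h ∷ hs) p q =
  trans (sym (factor p)) (trans (c (s ∘ punchIn x) (map⁺ (lift hs)) _ _) (factor q))
  where
  factor : ∀ z → s (punchIn x (merge x y z)) ≡ s z
  factor z with z ≟ x
  ... | yes refl = trans (cong s (punchIn-remove x (ne ∘ sym))) (sym h)
  ... | no  z≢x  = cong s (punchIn-remove x z≢x)
  lift : ∀ {A} → Potential s A → All (λ e → s (punchIn x (merge x y (proj₁ e))) ≡ s (punchIn x (merge x y (proj₂ e)))) A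
  lift []                  = []
  lift (_∷_ {x = e} h' hs) = trans (factor (proj₁ e)) (trans h' (sym (factor (proj₂ e)))) ∷ lift hs

Conn-length : ∀ k (A : List (Edge (suc k))) → Conn A → k ≤ length A
Conn-length zero    = λ A c → z≤n
Conn-length (suc k) = step
  where
  -- Removing a loop keeps `k` and shortens the list, contraction lowers `k` and changes the list;
  -- hence a recursion on lists inside the one on `k`.
  step : ∀ A → Conn A → suc k ≤ length A
  -- With no edges, the indicator of `zero` is an admissible colouring that separates two vertices.
  step []            c with c (_== zero) [] zero (suc zero)
  ... | ()
  step ((x , y) ∷ A) c with x ≟ y
  ... | yes refl = ≤-trans (step A (Conn-loop c)) (n≤1+n _)
  ... | no  ne   = s≤s (≤-trans (Conn-length k _ (Conn-contract ne c)) (≤-reflexive (length-map _ A)))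

tree⇒length : ∀ k (A : List (Edge (suc k))) → tree k A ≡ true → length A ≡ k
tree⇒length zero    []            t = refl
tree⇒length (suc k) ((x , y) ∷ A) t with x ≟ y
... | no ne = cong suc (trans (sym (length-map _ A)) (tree⇒length k _ t))

tree⇒Conn : ∀ k (A : List (Edge (suc k))) → tree k A ≡ true → Conn A
tree⇒Conn zero    []            t s h zero zero = refl
tree⇒Conn (suc k) ((x , y) ∷ A) t with x ≟ y
... | no ne = Conn-uncontract ne (tree⇒Conn k _ t)

Conn⇒tree : ∀ k (A : List (Edge (suc k))) → length A ≡ k → Conn A → tree k A ≡ true
Conn⇒tree zero    []            l c = refl
Conn⇒tree (suc k) ((x , y) ∷ A) l c with x ≟ y
... | no  ne   = Conn⇒tree k _ (trans (length-map _ A) (suc-injective l)) (Conn-contract ne c)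
... | yes refl = contradiction
  (≤-trans (Conn-length (suc k) A (Conn-loop c)) (≤-reflexive (suc-injective l))) 1+n≰n

Bool-ext : ∀ {a b : Bool} → (a ≡ true → b ≡ true) → (b ≡ true → a ≡ true) → a ≡ b
Bool-ext {true}  {b}     f g = sym (f refl)
Bool-ext {false} {true}  f g = g refl
Bool-ext {false} {false} f g = refl

-- The recursion is traded for a description free of order, `k` edges and connected, and both parts
-- are invariant.
tree-≋ : ∀ k → Invariant (tree k)
tree-≋ k p = Bool-ext (one p) (one (≋-sym p))
  where
  one : ∀ {A B} → A ≋ B → tree k A ≡ true → tree k B ≡ true
  one {A} {B} p t = Conn⇒tree k B (trans (sym (≋-length p)) (tree⇒length k A t)) (Conn-≋ p (tree⇒Conn k A t))

tree-length : ∀ k (A : List (Edge (suc k))) → length A ≢ k → tree k A ≡ false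
tree-length k A ne with tree k A in eq
... | true  = contradiction (tree⇒length k A eq) ne
... | false = refl

tree-loop : ∀ k x (A : List (Edge (suc k))) → tree k ((x , x) ∷ A) ≡ false
tree-loop zero    x A = refl
tree-loop (suc k) x A rewrite ==-refl x = refl

tree-double : ∀ k e (A : List (Edge (suc k))) → tree k (e ∷ e ∷ A) ≡ false
tree-double zero    e       A = refl
tree-double (suc k) (x , y) A rewrite merge-self x y | merge-target x y =
  trans (cong (not (x == y) ∧_) (tree-loop k (remove x y) _)) (∧-zeroʳ _)

-- The effect of fixed edges `C` on the tree test for varying `A`: a cycle in `C` makes every test
-- fail, and otherwise contracting `C` leaves `r + 1` vertices on which `A` alone is tested. Since
-- only `r = length A` can succeed, identities in one or two varying edges become finite checks.
data Contraction (k : ℕ) (C : List (Edge (suc k))) : Set where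
  cyclic  : (∀ A → tree k (A ++ C) ≡ false) → Contraction k C
  acyclic : ∀ r (φ : Fin (suc k) → Fin (suc r)) → k ≡ length C + r →
            (∀ A → tree k (A ++ C) ≡ tree r (map (mapᵉ φ) A)) → Contraction k C

contraction : ∀ k (C : List (Edge (suc k))) → Contraction k C
contraction k       []      = acyclic k id refl (λ A → cong (tree k) (trans (++-identityʳ A) (sym (map-id A))))
contraction zero    (e ∷ C) = cyclic (λ A → tree-≋ 0 (≋-shift e A C))
contraction (suc k) ((x , y) ∷ C) with x == y in x==y
... | true = cyclic λ A → trans (tree-≋ (suc k) (≋-shift (x , y) A C))
        (cong (λ b → not b ∧ tree k (map (mapᵉ (merge x y)) (A ++ C))) x==y)
... | false with contraction k (map (mapᵉ (merge x y)) C)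
...   | cyclic h = cyclic λ A → trans (tree-≋ (suc k) (≋-shift (x , y) A C))
        (trans (cong (λ b → not b ∧ tree k (map (mapᵉ (merge x y)) (A ++ C))) x==y)
        (trans (cong (tree k) (map-++ _ A C)) (h _)))
...   | acyclic r φ l h = acyclic r (φ ∘ merge x y) (cong suc (trans l (cong (_+ r) (length-map _ C)))) λ A →
        trans (tree-≋ (suc k) (≋-shift (x , y) A C))
        (trans (cong (λ b → not b ∧ tree k (map (mapᵉ (merge x y)) (A ++ C))) x==y)
        (trans (cong (tree k) (map-++ _ A C)) (trans (h _) (cong (tree r) (sym (map-∘ A))))))

-- Sums over splittings of an edge list and over Boolean vectors

Invariant₂ : {X : Set} → (List (Edge k) → List (Edge k) → X) → Set
Invariant₂ g = ∀ {A A′ B B′} → A ≋ A′ → B ≋ B′ → g A B ≡ g A′ B′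

-- Used for ℕ with `_+_`, where pairs of trees and zeros are counted, and for F₂ with `_xor_`, where
-- only parities matter.
module Sums {X : Set} {_⊕_ : Op₂ X} {ε : X} (isCommutativeMonoid : IsCommutativeMonoid _≡_ _⊕_ ε) where
  open IsCommutativeMonoid isCommutativeMonoid using (assoc; comm; identityˡ)

  interchange : ∀ a b c d → (a ⊕ b) ⊕ (c ⊕ d) ≡ (a ⊕ c) ⊕ (b ⊕ d)
  interchange a b c d = begin
    (a ⊕ b) ⊕ (c ⊕ d) ≡⟨ assoc a b (c ⊕ d) ⟩
    a ⊕ (b ⊕ (c ⊕ d)) ≡⟨ cong (a ⊕_) (trans (sym (assoc b c d)) (trans (cong (_⊕ d) (comm b c)) (assoc c b d))) ⟩
    a ⊕ (c ⊕ (b ⊕ d)) ≡⟨ assoc a c (b ⊕ d) ⟨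
    (a ⊕ c) ⊕ (b ⊕ d) ∎
    where open ≡-Reasoning

  splits : List (Edge k) → (List (Edge k) → List (Edge k) → X) → X
  splits []      g = g [] []
  splits (e ∷ E) g = splits E (λ A B → g (e ∷ A) B) ⊕ splits E (λ A B → g A (e ∷ B))

  splits-cong-length : ∀ (E : List (Edge k)) {g h} →
    (∀ A B → length A + length B ≡ length E → g A B ≡ h A B) → splits E g ≡ splits E h
  splits-cong-length []      eq = eq [] [] refl
  splits-cong-length (e ∷ E) eq = cong₂ _⊕_
    (splits-cong-length E λ A B l → eq (e ∷ A) B (cong suc l))
    (splits-cong-length E λ A B l → eq A (e ∷ B) (trans (+-suc (length A) (length B)) (cong suc l)))

  splits-cong : ∀ (E : List (Edge k)) {g h} → (∀ A B → g A B ≡ h A B) → splits E g ≡ splits E h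
  splits-cong E eq = splits-cong-length E (λ A B _ → eq A B)

  splits-ε : ∀ (E : List (Edge k)) {g} → (∀ A B → length A + length B ≡ length E → g A B ≡ ε) → splits E g ≡ ε
  splits-ε []      eq = eq [] [] refl
  splits-ε (e ∷ E) eq = trans (cong₂ _⊕_
    (splits-ε E λ A B l → eq (e ∷ A) B (cong suc l))
    (splits-ε E λ A B l → eq A (e ∷ B) (trans (+-suc (length A) (length B)) (cong suc l)))) (identityˡ ε)

  splits-⊕ : ∀ (E : List (Edge k)) g h → splits E (λ A B → g A B ⊕ h A B) ≡ splits E g ⊕ splits E h
  splits-⊕ []      g h = refl
  splits-⊕ (e ∷ E) g h = trans (cong₂ _⊕_ (splits-⊕ E _ _) (splits-⊕ E _ _)) (interchange _ _ _ _)

  splits-flip : ∀ (E : List (Edge k)) g → splits E (flip g) ≡ splits E g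
  splits-flip []      g = refl
  splits-flip (e ∷ E) g = trans (cong₂ _⊕_ (splits-flip E _) (splits-flip E _)) (comm _ _)

  splits-map : ∀ (φ : Edge j → Edge k) E g → splits (map φ E) g ≡ splits E (λ A B → g (map φ A) (map φ B))
  splits-map φ []      g = refl
  splits-map φ (e ∷ E) g = cong₂ _⊕_ (splits-map φ E _) (splits-map φ E _)

  splits-≋ : ∀ {E E′ : List (Edge k)} {g} → Invariant₂ g → E ≋ E′ → splits E g ≡ splits E′ g
  splits-≋ inv nil = refl
  splits-≋ inv (keep e p) = cong₂ _⊕_
    (splits-≋ (λ p q → inv (keep e p) q) p) (splits-≋ (λ p q → inv p (keep e q)) p)
  splits-≋ inv (turn x y E) = cong₂ _⊕_
    (splits-cong E λ A B → inv (turn x y A) ≋-refl) (splits-cong E λ A B → inv ≋-refl (turn x y B))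
  splits-≋ inv (exchange e f E) = trans (interchange _ _ _ _) (cong₂ _⊕_
    (cong₂ _⊕_ (splits-cong E λ A B → inv (exchange e f A) ≋-refl) refl)
    (cong₂ _⊕_ refl (splits-cong E λ A B → inv ≋-refl (exchange e f B))))
  splits-≋ inv (≋-trans p q) = trans (splits-≋ inv p) (splits-≋ inv q)

  ∑ᵇ : ℕ → (List Bool → X) → X
  ∑ᵇ zero    h = h []
  ∑ᵇ (suc n) h = ∑ᵇ n (h ∘ (false ∷_)) ⊕ ∑ᵇ n (h ∘ (true ∷_))

  ∑ᵇ-cong-length : ∀ n {g h} → (∀ α → length α ≡ n → g α ≡ h α) → ∑ᵇ n g ≡ ∑ᵇ n h
  ∑ᵇ-cong-length zero    eq = eq [] refl
  ∑ᵇ-cong-length (suc n) eq = cong₂ _⊕_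
    (∑ᵇ-cong-length n λ α l → eq (false ∷ α) (cong suc l)) (∑ᵇ-cong-length n λ α l → eq (true ∷ α) (cong suc l))

  ∑ᵇ-cong : ∀ n {g h} → (∀ α → g α ≡ h α) → ∑ᵇ n g ≡ ∑ᵇ n h
  ∑ᵇ-cong n eq = ∑ᵇ-cong-length n (λ α _ → eq α)

  ∑ᵇ-⊕ : ∀ n g h → ∑ᵇ n (λ α → g α ⊕ h α) ≡ ∑ᵇ n g ⊕ ∑ᵇ n h
  ∑ᵇ-⊕ zero    g h = refl
  ∑ᵇ-⊕ (suc n) g h = trans (cong₂ _⊕_ (∑ᵇ-⊕ n _ _) (∑ᵇ-⊕ n _ _)) (interchange _ _ _ _)

open Sums +-0-isCommutativeMonoid public
open Sums (CommutativeRing.+-isCommutativeMonoid xor-∧-commutativeRing) public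
  using ()
  renaming ( interchange to xor-interchange; splits to splits₂; splits-cong to splits₂-cong
           ; splits-ε to splits₂-ε; splits-⊕ to splits₂-xor
           ; splits-map to splits₂-map; splits-≋ to splits₂-≋; ∑ᵇ to ∑₂; ∑ᵇ-cong to ∑₂-cong; ∑ᵇ-⊕ to ∑₂-xor)

splits-*ˡ : ∀ c (E : List (Edge k)) g → splits E (λ A B → c * g A B) ≡ c * splits E g
splits-*ˡ c []      g = refl
splits-*ˡ c (e ∷ E) g = trans (cong₂ _+_ (splits-*ˡ c E _) (splits-*ˡ c E _)) (sym (*-distribˡ-+ c _ _))

∑ᵇ-*ˡ : ∀ c n h → ∑ᵇ n (λ α → c * h α) ≡ c * ∑ᵇ n h
∑ᵇ-*ˡ c zero    h = refl
∑ᵇ-*ˡ c (suc n) h = trans (cong₂ _+_ (∑ᵇ-*ˡ c n _) (∑ᵇ-*ˡ c n _)) (sym (*-distribˡ-+ c _ _))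

odd : ℕ → Bool
odd zero    = false
odd (suc n) = not (odd n)

odd-+ : ∀ m n → odd (m + n) ≡ odd m xor odd n
odd-+ zero    n = refl
odd-+ (suc m) n = trans (cong not (odd-+ m n)) (not-distribˡ-xor (odd m) (odd n))

odd-splits : ∀ (E : List (Edge k)) g → odd (splits E g) ≡ splits₂ E (λ A B → odd (g A B))
odd-splits []      g = refl
odd-splits (e ∷ E) g = trans (odd-+ (splits E _) _) (cong₂ _xor_ (odd-splits E _) (odd-splits E _))

odd-∑ᵇ : ∀ n h → odd (∑ᵇ n h) ≡ ∑₂ n (odd ∘ h)
odd-∑ᵇ zero    h = refl
odd-∑ᵇ (suc n) h = trans (odd-+ (∑ᵇ n _) _) (cong₂ _xor_ (odd-∑ᵇ n _) (odd-∑ᵇ n _))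

-- Alternating functions of edge lists

-- The rules satisfied mod 2 by A ↦ det (incidence matrix of A).
record Alternating (p : List (Edge k) → Bool) : Set where
  field
    inv      : Invariant p
    loop     : ∀ x A → p ((x , x) ∷ A) ≡ false
    double   : ∀ e A → p (e ∷ e ∷ A) ≡ false
    triangle : ∀ x y z A → p ((y , z) ∷ A) ≡ p ((x , y) ∷ A) xor p ((x , z) ∷ A)
open Alternating

triangle-Fin2 : ∀ x y z → tree 1 ((y , z) ∷ []) ≡ tree 1 ((x , y) ∷ []) xor tree 1 ((x , z) ∷ [])
triangle-Fin2 = from-yes (all? λ x → all? λ y → all? λ z →
  tree 1 ((y , z) ∷ []) Bool.≟ (tree 1 ((x , y) ∷ []) xor tree 1 ((x , z) ∷ [])))

-- With `A` contracted, a single edge is a spanning tree only on two vertices. There the claim is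
-- that three points of a two-element set are separated in an even number of pairs.
tree-triangle : ∀ k x y z (A : List (Edge (suc k))) → tree k ((y , z) ∷ A) ≡ tree k ((x , y) ∷ A) xor tree k ((x , z) ∷ A)
tree-triangle k x y z A with contraction k A
... | cyclic h = trans (h (_ ∷ [])) (sym (cong₂ _xor_ (h (_ ∷ [])) (h (_ ∷ []))))
... | acyclic r φ l h = trans (h (_ ∷ [])) (trans (small r φ) (sym (cong₂ _xor_ (h (_ ∷ [])) (h (_ ∷ [])))))
  where
  small : ∀ r (φ : Fin (suc k) → Fin (suc r)) → tree r ((φ y , φ z) ∷ []) ≡ tree r ((φ x , φ y) ∷ []) xor tree r ((φ x , φ z) ∷ [])
  small zero          φ = refl
  small (suc zero)    φ = triangle-Fin2 (φ x) (φ y) (φ z)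
  small (suc (suc r)) φ = trans (none (φ y , φ z)) (sym (cong₂ _xor_ (none (φ x , φ y)) (none (φ x , φ z))))
    where
    none : ∀ e → tree (2 + r) (e ∷ []) ≡ false
    none e = tree-length (2 + r) (e ∷ []) λ ()

tree-alternating : ∀ k → Alternating (tree k)
tree-alternating k = record
  { inv = tree-≋ k ; loop = tree-loop k ; double = tree-double k ; triangle = tree-triangle k }

∷-alternating : ∀ {p : List (Edge k) → Bool} e → Alternating p → Alternating (p ∘ (e ∷_))
∷-alternating e alt = record
  { inv      = λ q → inv alt (keep e q)
  ; loop     = λ x A → trans (inv alt (exchange _ _ _)) (loop alt x (e ∷ A))
  ; double   = λ f A → trans (inv alt (≋-trans (exchange _ _ _) (keep f (exchange _ _ _)))) (double alt f (e ∷ A))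
  ; triangle = λ x y z A → trans (inv alt (exchange _ _ _)) (trans (triangle alt x y z (e ∷ A))
                 (cong₂ _xor_ (inv alt (exchange _ _ _)) (inv alt (exchange _ _ _))))
  }

module _ {X : Set} (f : X → Edge k) where

  extract₁ : ∀ (xs : List X) i → ∃ λ ys → map f xs ≋ f (lookup xs i) ∷ map f ys
  extract₁ (x ∷ xs) zero    = xs , ≋-refl
  extract₁ (x ∷ xs) (suc i) with extract₁ xs i
  ... | ys , p = x ∷ ys , ≋-trans (keep _ p) (exchange _ _ _)

  extract₂ : ∀ (xs : List X) i j → i Fin.< j → ∃ λ ys → map f xs ≋ f (lookup xs i) ∷ f (lookup xs j) ∷ map f ys
  extract₂ (x ∷ xs) zero    (suc j) i<j with extract₁ xs j
  ... | ys , p = ys , keep _ p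
  extract₂ (x ∷ xs) (suc i) (suc j) (s≤s i<j) with extract₂ xs i j i<j
  ... | ys , p = x ∷ ys , ≋-trans (keep _ p) (≋-trans (exchange _ _ _) (keep _ (exchange _ _ _)))

module _ {p q : List (Edge (suc k)) → Bool} (p-alt : Alternating p) (q-alt : Alternating q) where

  private
    -- The exterior product of `p` and `q` mod 2.
    P : List (Edge (suc k)) → Bool
    P E = splits₂ E (λ A B → p A ∧ q B)

    P-≋ : Invariant P
    P-≋ = splits₂-≋ λ r s → cong₂ _∧_ (inv p-alt r) (inv q-alt s)

    P-loop : ∀ x E → P ((x , x) ∷ E) ≡ false
    P-loop x E = cong₂ _xor_ (splits₂-ε E λ A B _ → cong (_∧ q B) (loop p-alt x A))
      (splits₂-ε E λ A B _ → trans (cong (p A ∧_) (loop q-alt x B)) (∧-zeroʳ (p A)))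

    -- Terms with both copies on one side vanish; the two terms with one copy on each side are equal
    -- and cancel mod 2.
    P-double : ∀ e E → P (e ∷ e ∷ E) ≡ false
    P-double e E = trans (cong₂ _xor_
      (cong (_xor splits₂ E (λ A B → p (e ∷ A) ∧ q (e ∷ B))) (splits₂-ε E λ A B _ → cong (_∧ q B) (double p-alt e A)))
      (trans (cong (splits₂ E (λ A B → p (e ∷ A) ∧ q (e ∷ B)) xor_)
        (splits₂-ε E λ A B _ → trans (cong (p A ∧_) (double q-alt e B)) (∧-zeroʳ (p A)))) (xor-identityʳ (splits₂ E (λ A B → p (e ∷ A) ∧ q (e ∷ B))))))
      (xor-same (splits₂ E (λ A B → p (e ∷ A) ∧ q (e ∷ B))))

    P-triangle : ∀ x y z E → P ((y , z) ∷ E) ≡ P ((x , y) ∷ E) xor P ((x , z) ∷ E)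
    P-triangle x y z E = trans (cong₂ _xor_
      (trans (splits₂-cong E λ A B → trans (cong (_∧ q B) (triangle p-alt x y z A)) (∧-distribʳ-xor (q B) (p ((x , y) ∷ A)) (p ((x , z) ∷ A)))) (splits₂-xor E _ _))
      (trans (splits₂-cong E λ A B → trans (cong (p A ∧_) (triangle q-alt x y z B)) (∧-distribˡ-xor (p A) (q ((x , y) ∷ B)) (q ((x , z) ∷ B)))) (splits₂-xor E _ _)))
      (xor-interchange (splits₂ E (λ A B → p ((x , y) ∷ A) ∧ q B)) (splits₂ E (λ A B → p ((x , z) ∷ A) ∧ q B)) _ _)

    star : Fin (suc k) → Edge (suc k)
    star x = zero , x

    P-star : ∀ xs → k < length xs → P (map star xs) ≡ false
    -- Listing the centre `zero` along with the ends lets one pigeonhole cover both cases: a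
    -- coincidence with `zero` is a loop, any other is a repeated edge.
    P-star xs l with pigeonhole (s≤s l) (lookup (zero ∷ xs))
    ... | zero , suc j , _ , eq with extract₁ star xs j
    ...   | ys , r = trans (P-≋ r) (trans (cong (λ x → P (star x ∷ map star ys)) (sym eq)) (P-loop zero (map star ys)))
    P-star xs l | suc i , suc j , s≤s i<j , eq with extract₂ star xs i j i<j
    ...   | ys , r = trans (P-≋ r) (trans (cong (λ x → P (star x ∷ star (lookup xs j) ∷ map star ys)) eq) (P-double (star (lookup xs j)) (map star ys)))

    P-expand : ∀ xs E → k < length xs + length E → P (map star xs ++ E) ≡ false
    P-expand xs [] l = trans (cong P (++-identityʳ (map star xs)))
      (P-star xs (≤-trans l (≤-reflexive (ℕ.+-identityʳ _))))
    -- The triangle rule with apex `zero` replaces an arbitrary edge by two edges of the star.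
    P-expand xs ((y , z) ∷ E) l = trans (P-≋ (≋-shift _ (map star xs) E)) (trans (P-triangle zero y z (map star xs ++ E))
      (cong₂ _xor_ (P-expand (y ∷ xs) E l′) (P-expand (z ∷ xs) E l′)))
      where
      l′ : k < suc (length xs + length E)
      l′ = ≤-trans l (≤-reflexive (+-suc (length xs) (length E)))

  -- The sum is an alternating function of E, and all edges are combinations of k star edges.
  splits-alternating : ∀ E → k < length E → splits₂ E (λ A B → p A ∧ q B) ≡ false
  splits-alternating = P-expand []

-- The Kirchhoff polynomial over F₂

-- Σ_{A ⊆ E} p(A) ∏_{e ∈ E∖A} α_e; the clause for a too short α is junk.
S : List (Edge k) → List Bool → (List (Edge k) → Bool) → Bool
S []      _           p = p []
S (e ∷ E) []          p = false
S (e ∷ E) (false ∷ α) p = S E α (λ A → p (e ∷ A))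
S (e ∷ E) (true ∷ α)  p = S E α (λ A → p (e ∷ A) xor p A)

S-cong : ∀ (E : List (Edge k)) α {p q} → (∀ A → p A ≡ q A) → S E α p ≡ S E α q
S-cong []      α           eq = eq []
S-cong (e ∷ E) []          eq = refl
S-cong (e ∷ E) (false ∷ α) eq = S-cong E α (λ A → eq (e ∷ A))
S-cong (e ∷ E) (true ∷ α)  eq = S-cong E α (λ A → cong₂ _xor_ (eq (e ∷ A)) (eq A))

S-xor : ∀ (E : List (Edge k)) α p q → S E α (λ A → p A xor q A) ≡ S E α p xor S E α q
S-xor []      α           p q = refl
S-xor (e ∷ E) []          p q = refl
S-xor (e ∷ E) (false ∷ α) p q = S-xor E α _ _
S-xor (e ∷ E) (true ∷ α)  p q = trans
  (S-cong E α λ A → xor-interchange (p (e ∷ A)) (q (e ∷ A)) (p A) (q A)) (S-xor E α _ _)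

S-false : ∀ (E : List (Edge k)) α → S E α (λ _ → false) ≡ false
S-false []      α           = refl
S-false (e ∷ E) []          = refl
S-false (e ∷ E) (false ∷ α) = S-false E α
S-false (e ∷ E) (true ∷ α)  = S-false E α

S-∷ : ∀ e (E : List (Edge k)) a α p → S (e ∷ E) (a ∷ α) p ≡ S E α (p ∘ (e ∷_)) xor (a ∧ S E α p)
S-∷ e E false α p = sym (xor-identityʳ (S E α (p ∘ (e ∷_))))
S-∷ e E true  α p = S-xor E α (p ∘ (e ∷_)) p

S-map : ∀ (φ : Edge j → Edge k) E α p → S (map φ E) α p ≡ S E α (p ∘ map φ)
S-map φ []      α           p = refl
S-map φ (e ∷ E) []          p = refl
S-map φ (e ∷ E) (false ∷ α) p = S-map φ E α _
S-map φ (e ∷ E) (true ∷ α)  p = S-map φ E α _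

-- Reordering the edges permutes the coordinates of `α`. The value at a fixed `α` may change, the
-- sum over all points does not.
∑-S-≋ : ∀ {E E′ : List (Edge k)} {p} (h : Bool → ℕ) → Invariant p → E ≋ E′ →
  ∑ᵇ (length E) (λ α → h (S E α p)) ≡ ∑ᵇ (length E′) (λ α → h (S E′ α p))
∑-S-≋ h inv nil = refl
∑-S-≋ h inv (keep e r) = cong₂ _+_ (∑-S-≋ h (inv ∘ keep e) r)
  (∑-S-≋ h (λ s → cong₂ _xor_ (inv (keep e s)) (inv s)) r)
∑-S-≋ {p = p} h inv (turn x y E) = cong₂ _+_
  (∑ᵇ-cong (length E) λ α → cong h (S-cong E α λ A → inv (turn x y A)))
  (∑ᵇ-cong (length E) λ α → cong h (S-cong E α λ A → cong (_xor p A) (inv (turn x y A))))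
∑-S-≋ {p = p} h inv (exchange e f E) = trans
  (interchange (∑ᵇ (length E) λ α → h (S E α λ A → p (e ∷ f ∷ A))) _ _ _)
  (cong₂ _+_
    (cong₂ _+_ (∑ᵇ-cong (length E) λ α → cong h (S-cong E α λ A → inv (exchange e f A)))
               (∑ᵇ-cong (length E) λ α → cong h (S-cong E α λ A → cong (_xor p (f ∷ A)) (inv (exchange e f A)))))
    (cong₂ _+_ (∑ᵇ-cong (length E) λ α → cong h (S-cong E α λ A → cong (_xor p (e ∷ A)) (inv (exchange e f A))))
               (∑ᵇ-cong (length E) λ α → cong h (S-cong E α λ A → trans
                 (cong (λ b → (b xor p (f ∷ A)) xor (p (e ∷ A) xor p A)) (inv (exchange e f A)))
                 (xor-interchange (p (f ∷ e ∷ A)) (p (f ∷ A)) (p (e ∷ A)) (p A))))))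
∑-S-≋ h inv (≋-trans r s) = trans (∑-S-≋ h inv r) (∑-S-≋ h inv s)

-- Products S(p) S(q), sorted by the common edges C and the edges D in exactly one factor.
S² : List (Edge k) → List Bool → (List (Edge k) → List (Edge k) → Bool) → Bool
S² []      _           r = r [] []
S² (e ∷ E) []          r = false
S² (e ∷ E) (false ∷ α) r = S² E α (λ C D → r (e ∷ C) D)
S² (e ∷ E) (true ∷ α)  r = S² E α (λ C D → (r (e ∷ C) D xor r C (e ∷ D)) xor r C D)

S²-cong : ∀ (E : List (Edge k)) α {r s} → (∀ C D → r C D ≡ s C D) → S² E α r ≡ S² E α s
S²-cong []      α           eq = eq [] []
S²-cong (e ∷ E) []          eq = refl
S²-cong (e ∷ E) (false ∷ α) eq = S²-cong E α λ C D → eq (e ∷ C) D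
S²-cong (e ∷ E) (true ∷ α)  eq = S²-cong E α λ C D → cong₂ _xor_ (cong₂ _xor_ (eq (e ∷ C) D) (eq C (e ∷ D))) (eq C D)

S²-xor : ∀ (E : List (Edge k)) α r s → S² E α (λ C D → r C D xor s C D) ≡ S² E α r xor S² E α s
S²-xor []      α           r s = refl
S²-xor (e ∷ E) []          r s = refl
S²-xor (e ∷ E) (false ∷ α) r s = S²-xor E α _ _
S²-xor (e ∷ E) (true ∷ α)  r s = trans (S²-cong E α λ C D → trans
  (cong (_xor (r C D xor s C D)) (xor-interchange (r (e ∷ C) D) (s (e ∷ C) D) (r C (e ∷ D)) (s C (e ∷ D))))
  (xor-interchange (r (e ∷ C) D xor r C (e ∷ D)) _ (r C D) (s C D))) (S²-xor E α _ _)

-- Selects the pairs of equal edge sets, so that a single sum `S` can be compared with a product,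
-- which is written as `S²`.
onlyCommon : (List (Edge k) → Bool) → List (Edge k) → List (Edge k) → Bool
onlyCommon p C []      = p C
onlyCommon p C (_ ∷ _) = false

S²-onlyCommon : ∀ (E : List (Edge k)) α p → S² E α (onlyCommon p) ≡ S E α p
S²-onlyCommon []      α           p = refl
S²-onlyCommon (e ∷ E) []          p = refl
S²-onlyCommon (e ∷ E) (false ∷ α) p =
  trans (S²-cong E α λ { C [] → refl ; C (_ ∷ _) → refl }) (S²-onlyCommon E α (p ∘ (e ∷_)))
S²-onlyCommon (e ∷ E) (true ∷ α)  p = trans
  (S²-cong E α {s = onlyCommon λ A → p (e ∷ A) xor p A}
    λ { C [] → cong (_xor p C) (xor-identityʳ (p (e ∷ C))) ; C (_ ∷ _) → refl })
  (S²-onlyCommon E α _)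

crossSum : (p q : List (Edge k) → Bool) → List (Edge k) → List (Edge k) → Bool
crossSum p q C D = splits₂ D (λ D₁ D₂ → p (D₁ ++ C) ∧ q (D₂ ++ C))

xor-∧-expand : ∀ a b c d → (a xor b) ∧ (c xor d) ≡ ((a ∧ c) xor ((a ∧ d) xor (b ∧ c))) xor (b ∧ d)
xor-∧-expand false false c     d     = refl
xor-∧-expand false true  false d     = refl
xor-∧-expand false true  true  d     = refl
xor-∧-expand true  false false d     = sym (trans (xor-identityʳ _) (xor-identityʳ d))
xor-∧-expand true  false true  d     = sym (trans (xor-identityʳ _) (cong not (xor-identityʳ d)))
xor-∧-expand true  true  false d     = sym (trans (cong (_xor d) (xor-identityʳ d)) (xor-same d))
xor-∧-expand true  true  true  false = refl
xor-∧-expand true  true  true  true  = refl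

-- Multiply out edge by edge with `α_e² = α_e`. An edge chosen in both factors goes to `C`, an edge
-- chosen in exactly one goes to `D`, where `crossSum` sums over the two sides; every edge outside
-- `C` contributes one factor `α_e`.
S-* : ∀ (E : List (Edge k)) α {p q} → Invariant p → Invariant q →
  S E α p ∧ S E α q ≡ S² E α (crossSum p q)
S-* []      α           p-inv q-inv = refl
S-* (e ∷ E) []          p-inv q-inv = refl
S-* (e ∷ E) (false ∷ α) {p} {q} p-inv q-inv = trans (S-* E α (p-inv ∘ keep e) (q-inv ∘ keep e))
  (S²-cong E α λ C D → splits₂-cong D λ D₁ D₂ → cong₂ _∧_ (p-inv (≋-sym (≋-shift e D₁ C))) (q-inv (≋-sym (≋-shift e D₂ C))))
S-* (e ∷ E) (true ∷ α) {p} {q} p-inv q-inv = trans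
  (S-* E α (λ r → cong₂ _xor_ (p-inv (keep e r)) (p-inv r)) (λ r → cong₂ _xor_ (q-inv (keep e r)) (q-inv r)))
  (S²-cong E α λ C D → trans
    (splits₂-cong D λ D₁ D₂ → trans
      (xor-∧-expand (p (e ∷ D₁ ++ C)) (p (D₁ ++ C)) (q (e ∷ D₂ ++ C)) (q (D₂ ++ C)))
      (cong (λ b → (b xor ((p (e ∷ D₁ ++ C) ∧ q (D₂ ++ C)) xor (p (D₁ ++ C) ∧ q (e ∷ D₂ ++ C)))) xor (p (D₁ ++ C) ∧ q (D₂ ++ C)))
        (cong₂ _∧_ (p-inv (≋-sym (≋-shift e D₁ C))) (q-inv (≋-sym (≋-shift e D₂ C))))))
    (trans (splits₂-xor D _ _) (cong (_xor crossSum p q C D)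
      (trans (splits₂-xor D _ _) (cong (crossSum p q (e ∷ C) D xor_) (splits₂-xor D _ _))))))

-- After contracting `C` to `r + 1` vertices the sum is an exterior product, which vanishes if `M`
-- has more than `r` edges. Otherwise a nonzero term would need `r + (r - 1) = |M| ≤ r`, hence
-- `|M| ≤ 1`.
split-trees : ∀ k (C M : List (Edge (suc k))) w → 2 ≤ length M →
  splits₂ M (λ A B → tree k (A ++ C) ∧ tree k (w ∷ B ++ C)) ≡ false
split-trees k C M w l with contraction k C
... | cyclic h = splits₂-ε M λ A B _ → cong (_∧ _) (h A)
... | acyclic r φ _ h = trans (splits₂-cong M λ A B → cong₂ _∧_ (h A) (h (w ∷ B)))
  (trans (sym (splits₂-map (mapᵉ φ) M λ A B → tree r A ∧ tree r (mapᵉ φ w ∷ B))) small)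
  where
  absurd : ∀ a b m → a ≡ r → suc b ≡ r → a + b ≡ m → 2 ≤ m → m ≤ r → ⊥
  absurd .(suc b) b .(suc (b + b)) refl refl refl (s≤s 1≤) (s≤s le) with b
  ... | zero   = contradiction 1≤ λ ()
  ... | suc b′ = 1+n≰n (≤-trans (s≤s (ℕ.m≤n+m (suc b′) b′)) le)
  small : splits₂ (map (mapᵉ φ) M) (λ A B → tree r A ∧ tree r (mapᵉ φ w ∷ B)) ≡ false
  small with suc r ≤? length (map (mapᵉ φ) M)
  ... | yes r< = splits-alternating (tree-alternating r) (∷-alternating (mapᵉ φ w) (tree-alternating r)) (map (mapᵉ φ) M) r<
  ... | no r≮ = splits₂-ε (map (mapᵉ φ) M) λ A B e → short A B e
    where
    short : ∀ A B → length A + length B ≡ length (map (mapᵉ φ) M) → tree r A ∧ tree r (mapᵉ φ w ∷ B) ≡ false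
    short A B e with tree r A in a | tree r (mapᵉ φ w ∷ B) in b
    ... | false | _     = refl
    ... | true  | false = refl
    ... | true  | true  = ⊥-elim (absurd (length A) (length B) _ (tree⇒length r A a) (tree⇒length r _ b) e
      (≤-trans l (≤-reflexive (sym (length-map _ M)))) (ℕ.≮⇒≥ r≮))

-- Jacobi's identity for the minors of the Laplacian.
jacobi : ∀ k (E : List (Edge (suc k))) α u w →
  S E α (tree k ∘ (u ∷_)) ∧ S E α (tree k ∘ (w ∷_)) ≡
  S E α (λ A → tree k (u ∷ A) ∧ tree k (w ∷ A)) xor (S E α (tree k) ∧ S E α (λ A → tree k (w ∷ u ∷ A)))
jacobi k E α u w = trans (S-* E α (t-inv ∘ keep u) (t-inv ∘ keep w)) (trans
  (S²-cong E α λ C D → move _ _ _ (local C D))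
  (trans (S²-xor E α _ _) (cong₂ _xor_ (S²-onlyCommon E α _)
    (sym (S-* E α t-inv (λ r → t-inv (keep w (keep u r))))))))
  where
  t-inv : Invariant (tree k)
  t-inv = tree-≋ k
  move : ∀ a b c → a xor b ≡ c → a ≡ c xor b
  move a b c eq = trans (sym (xor-identityʳ a)) (trans (cong (a xor_) (sym (xor-same b)))
    (trans (sym (xor-assoc a b b)) (cong (_xor b) eq)))
  local : ∀ C D → crossSum (tree k ∘ (u ∷_)) (tree k ∘ (w ∷_)) C D xor crossSum (tree k) (λ A → tree k (w ∷ u ∷ A)) C D
                ≡ onlyCommon (λ A → tree k (u ∷ A) ∧ tree k (w ∷ A)) C D
  local C [] = trans (cong ((tree k (u ∷ C) ∧ tree k (w ∷ C)) xor_) none) (xor-identityʳ _)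
    where
    none : tree k C ∧ tree k (w ∷ u ∷ C) ≡ false
    none with tree k C in a
    ... | false = refl
    ... | true  = tree-length k (w ∷ u ∷ C) λ eq → ℕ.m+1+n≢n 1 (trans eq (sym (tree⇒length k C a)))
  -- Together the two cross sums run over the splittings of `u ∷ f ∷ D`: in the first `u` lies on
  -- the left, in the second on the right.
  local C (f ∷ D) = split-trees k C (u ∷ f ∷ D) w (s≤s (s≤s z≤n))

-- `S` is linear in each variable, so summing over all points leaves the coefficient of the product
-- of all variables, which comes from the empty set.
∑-S : ∀ (E : List (Edge k)) p → ∑₂ (length E) (λ α → S E α p) ≡ p []
∑-S []      p = refl
∑-S (e ∷ E) p = trans (cong₂ _xor_ (∑-S E (p ∘ (e ∷_))) (∑-S E (λ A → p (e ∷ A) xor p A)))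
  (trans (sym (xor-assoc (p (e ∷ [])) _ _)) (cong (_xor p []) (xor-same (p (e ∷ [])))))

-- Over the two values of `α_e`, the product `(a + α_e b)(c + α_e d)` sums to `ad + bc + bd`. An
-- edge in both sets cancels. The term `bd`, an edge in neither set, is due to `α_e² = α_e` and has
-- to be excluded by a degree bound.
∑-S-∷ : ∀ e (E : List (Edge k)) p q →
  ∑₂ (suc (length E)) (λ α → S (e ∷ E) α p ∧ S (e ∷ E) α q) ≡
  (∑₂ (length E) (λ α → S E α (p ∘ (e ∷_)) ∧ S E α q) xor ∑₂ (length E) (λ α → S E α p ∧ S E α (q ∘ (e ∷_))))
  xor ∑₂ (length E) (λ α → S E α p ∧ S E α q)
∑-S-∷ e E p q = trans (sym (∑₂-xor (length E) _ _)) (trans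
  (∑₂-cong (length E) λ α → trans (cong (S E α (p ∘ (e ∷_)) ∧ S E α (q ∘ (e ∷_)) xor_) (cong₂ _∧_ (S-xor E α _ _) (S-xor E α _ _)))
    (cancel (S E α (p ∘ (e ∷_))) (S E α p) (S E α (q ∘ (e ∷_))) (S E α q)))
  (trans (∑₂-xor (length E) _ _) (cong (_xor ∑₂ (length E) (λ α → S E α p ∧ S E α q)) (∑₂-xor (length E) _ _))))
  where
  cancel : ∀ a b c d → (a ∧ c) xor ((a xor b) ∧ (c xor d)) ≡ ((a ∧ d) xor (b ∧ c)) xor (b ∧ d)
  cancel a b c d = trans (cong ((a ∧ c) xor_) (trans (xor-∧-expand a b c d) (xor-assoc (a ∧ c) _ _)))
    (trans (sym (xor-assoc (a ∧ c) (a ∧ c) _)) (cong (_xor (((a ∧ d) xor (b ∧ c)) xor (b ∧ d))) (xor-same (a ∧ c))))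

∑-S*S-false : ∀ (E : List (Edge k)) p q → (∀ A B → length A + length B ≤ length E → p A ∧ q B ≡ false) →
  ∑₂ (length E) (λ α → S E α p ∧ S E α q) ≡ false
∑-S*S-false []      p q h = h [] [] z≤n
∑-S*S-false (e ∷ E) p q h = trans (∑-S-∷ e E p q) (cong₂ _xor_ (cong₂ _xor_
  (∑-S*S-false E _ q λ A B l → h (e ∷ A) B (s≤s l))
  (∑-S*S-false E p _ λ A B l → h A (e ∷ B) (≤-trans (≤-reflexive (+-suc (length A) (length B))) (s≤s l))))
  (∑-S*S-false E p q λ A B l → h A B (≤-trans l (n≤1+n _))))

-- Overlaps cancel, so a remaining pair that misses an edge has fewer than `length E` edges in total
-- and is killed by the hypothesis. Only partitions stay.
∑-S*S : ∀ (E : List (Edge k)) p q → (∀ A B → length A + length B < length E → p A ∧ q B ≡ false) →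
  ∑₂ (length E) (λ α → S E α p ∧ S E α q) ≡ splits₂ E (λ A B → p A ∧ q B)
∑-S*S []      p q h = refl
∑-S*S (e ∷ E) p q h = trans (∑-S-∷ e E p q) (trans (cong₂ _xor_ (cong₂ _xor_
  (∑-S*S E _ q λ A B l → h (e ∷ A) B (s≤s l))
  (∑-S*S E p _ λ A B l → h A (e ∷ B) (≤-trans (≤-reflexive (cong suc (+-suc (length A) (length B)))) (s≤s l))))
  (∑-S*S-false E p q λ A B l → h A B (s≤s l))) (xor-identityʳ _))

-- Spanning trees near a vertex of small degree

module _ (x : Fin (2 + k)) where

  private
    π : List (Edge (1 + k)) → List (Edge (2 + k))
    π = map (mapᵉ (punchIn x))

    merge-π : ∀ y A → map (mapᵉ (merge x y)) (π A) ≡ A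
    merge-π y A = trans (sym (map-∘ A)) (trans (map-cong (λ (p , q) → cong₂ _,_ (merge-punchIn x y p) (merge-punchIn x y q)) A) (map-id A))

    merge-edge : ∀ y z → mapᵉ (merge x (punchIn x y)) (x , punchIn x z) ≡ (y , z)
    merge-edge y z = cong₂ _,_ (trans (merge-self x _) (remove-punchIn x y)) (merge-punchIn x _ z)

    contract-leaf : ∀ y B → tree (suc k) ((x , punchIn x y) ∷ B) ≡ tree k (map (mapᵉ (merge x (punchIn x y))) B)
    contract-leaf y B = cong (λ b → not b ∧ tree k (map (mapᵉ (merge x (punchIn x y))) B)) (≢⇒== (punchInᵢ≢i x y ∘ sym))

  tree-isolated : ∀ A → tree (suc k) (π A) ≡ false
  tree-isolated A with tree (suc k) (π A) in eq
  ... | false = refl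
  ... | true  = trans (sym (==-refl x)) (trans (tree⇒Conn (suc k) (π A) eq (_== x) (potential A) x (punchIn x zero)) (≢⇒== (punchInᵢ≢i x zero)))
    where
    potential : ∀ A → Potential (_== x) (π A)
    potential []            = []
    potential ((p , q) ∷ A) = trans (≢⇒== (punchInᵢ≢i x p)) (sym (≢⇒== (punchInᵢ≢i x q))) ∷ potential A

  tree-degree1 : ∀ y A → tree (suc k) ((x , punchIn x y) ∷ π A) ≡ tree k A
  tree-degree1 y A = trans (contract-leaf y _) (cong (tree k) (merge-π _ A))

  -- Contracting the edge from `x` to `y` makes the other edge at `x` start at `y`.
  tree-degree2 : ∀ y z A → tree (suc k) ((x , punchIn x y) ∷ (x , punchIn x z) ∷ π A) ≡ tree k ((y , z) ∷ A)
  tree-degree2 y z A = trans (contract-leaf y ((x , punchIn x z) ∷ π A)) (cong (tree k) (cong₂ _∷_ (merge-edge y z) (merge-π _ A)))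

  tree-degree3 : ∀ y z u A → tree (suc k) ((x , punchIn x y) ∷ (x , punchIn x z) ∷ (x , punchIn x u) ∷ π A) ≡ tree k ((y , z) ∷ (y , u) ∷ A)
  tree-degree3 y z u A = trans (contract-leaf y ((x , punchIn x z) ∷ (x , punchIn x u) ∷ π A))
    (cong (tree k) (cong₂ _∷_ (merge-edge y z) (cong₂ _∷_ (merge-edge y u) (merge-π _ A))))

-- Zeros of the Kirchhoff polynomial and pairs of spanning trees

bit : Bool → ℕ
bit true  = 1
bit false = 0

odd-bit : ∀ b → odd (bit b) ≡ b
odd-bit true  = refl
odd-bit false = refl

bit-∧ : ∀ a b → bit (a ∧ b) ≡ bit a * bit b
bit-∧ false b = refl
bit-∧ true  b = sym (ℕ.+-identityʳ (bit b))

n%2≡bit : ∀ n → n % 2 ≡ bit (odd n)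
n%2≡bit zero          = refl
n%2≡bit (suc zero)    = refl
n%2≡bit (suc (suc n)) = trans (cong (_% 2) (ℕ.+-comm 2 n)) (trans ([m+n]%n≡m%n n 2) (trans (n%2≡bit n) (cong bit (sym (not-involutive (odd n))))))

zeros : ∀ k → List (Edge (suc k)) → ℕ
zeros k E = ∑ᵇ (length E) (λ α → bit (not (S E α (tree k))))

treePairs : ∀ k → List (Edge (suc k)) → ℕ
treePairs k E = splits E (λ A B → bit (tree k A) * bit (tree k B))

zeros-≋ : ∀ k → Invariant (zeros k)
zeros-≋ k = ∑-S-≋ (bit ∘ not) (tree-≋ k)

treePairs-≋ : ∀ k → Invariant (treePairs k)
treePairs-≋ k = splits-≋ λ p q → cong₂ (λ a b → bit a * bit b) (tree-≋ k p) (tree-≋ k q)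

module _ (k : ℕ) (K : List (Edge (suc k))) (x y z : Fin (suc k)) where

  private
    E : List (Edge (2 + k))
    E = (zero , suc x) ∷ (zero , suc y) ∷ (zero , suc z) ∷ map (mapᵉ suc) K

    -- A is a spanning forest with two components, and x, y, z are not all in the same one.
    sep : List (Edge (suc k)) → Bool
    sep A = tree k ((x , z) ∷ A) ∨ tree k ((x , y) ∷ A)

    f₀ f₁ f₂ f₃ f₁₂ : List Bool → Bool
    f₀  α = S K α (tree k)
    f₁  α = S K α (λ A → tree k ((x , y) ∷ A))
    f₂  α = S K α (λ A → tree k ((x , z) ∷ A))
    f₃  α = S K α (λ A → tree k ((x , y) ∷ (x , z) ∷ A))
    f₁₂ α = S K α (λ A → tree k ((x , z) ∷ A) ∧ tree k ((x , y) ∷ A))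

    -- The Kirchhoff polynomial in the variables of the three edges at `zero`. A variable stands for
    -- an edge outside the tree, so `c` belongs to all three edges inside, and `xyz` has coefficient
    -- 0 because `zero` would be isolated. The coefficient `a + b` of `x` comes from the triangle
    -- rule.
    value : (x y z f a b c : Bool) → Bool
    value x y z f a b c =
      ((c xor (z ∧ a)) xor (y ∧ (b xor (z ∧ f)))) xor (x ∧ (((a xor b) xor (z ∧ f)) xor (y ∧ (f xor (z ∧ false)))))

    S-value : ∀ x′ y′ z′ α → S E (x′ ∷ y′ ∷ z′ ∷ α) (tree (suc k)) ≡
      value x′ y′ z′ (f₀ α) (f₁ α) (f₂ α) (f₃ α)
    S-value x′ y′ z′ α =
      trans (S-∷ _ _ x′ _ _) (cong₂ (λ p q → p xor (x′ ∧ q))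
        (trans (S-∷ _ _ y′ _ _) (cong₂ (λ p q → p xor (y′ ∧ q))
          (trans (S-∷ _ _ z′ α _) (cong₂ (λ p q → p xor (z′ ∧ q))
            (restrict (tree-degree3 zero x y z)) (restrict (tree-degree2 zero x y))))
          (trans (S-∷ _ _ z′ α _) (cong₂ (λ p q → p xor (z′ ∧ q))
            (restrict (tree-degree2 zero x z)) (restrict (tree-degree1 zero x))))))
        (trans (S-∷ _ _ y′ _ _) (cong₂ (λ p q → p xor (y′ ∧ q))
          (trans (S-∷ _ _ z′ α _) (cong₂ (λ p q → p xor (z′ ∧ q))
            (trans (restrict (λ A → trans (tree-degree2 zero y z A) (tree-triangle k x y z A))) (S-xor K α _ _))
            (restrict (tree-degree1 zero y))))
          (trans (S-∷ _ _ z′ α _) (cong₂ (λ p q → p xor (z′ ∧ q))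
            (restrict (tree-degree1 zero z)) (trans (restrict (tree-isolated zero)) (S-false K α)))))))
      where
      restrict : ∀ {p q} → (∀ A → p (map (mapᵉ suc) A) ≡ q A) → S (map (mapᵉ suc) K) α p ≡ S K α q
      restrict {p} eq = trans (S-map (mapᵉ suc) K α p) (S-cong K α eq)

    -- For `f = 1`, adding (1, 1, 1) to (x, y, z) flips the value. For `f = 0` the polynomial is
    -- affine, and constant only if `a = b = 0`. So there are 4 zeros, except for the constant `c`,
    -- which has 0 or 8.
    quarter : (f a b c : Bool) → ℕ
    quarter f a b c = if f ∨ a ∨ b then 1 else (if c then 0 else 2)

    module _ (f a b c : Bool) where
      cell : Bool → Bool → Bool → ℕ
      cell x y z = bit (not (value x y z f a b c))
      cells : ℕ
      cells = ((cell false false false + cell false false true) + (cell false true false + cell false true true))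
            + ((cell true false false + cell true false true) + (cell true true false + cell true true true))

    cells-quarter : ∀ f a b c → cells f a b c ≡ 4 * quarter f a b c
    cells-quarter true  true  true  true  = refl
    cells-quarter true  true  true  false = refl
    cells-quarter true  true  false true  = refl
    cells-quarter true  true  false false = refl
    cells-quarter true  false true  true  = refl
    cells-quarter true  false true  false = refl
    cells-quarter true  false false true  = refl
    cells-quarter true  false false false = refl
    cells-quarter false true  true  true  = refl
    cells-quarter false true  true  false = refl
    cells-quarter false true  false true  = refl
    cells-quarter false true  false false = refl
    cells-quarter false false true  true  = refl
    cells-quarter false false true  false = refl
    cells-quarter false false false true  = refl
    cells-quarter false false false false = refl

    quarters : ℕ
    quarters = ∑ᵇ (length K) λ α → quarter (f₀ α) (f₁ α) (f₂ α) (f₃ α)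

    zeros-quarters : zeros (suc k) E ≡ 4 * quarters
    zeros-quarters rewrite length-map (mapᵉ (suc {suc k})) K = trans (sym (trans
      (∑ᵇ-⊕ #K _ _) (cong₂ _+_ (trans (∑ᵇ-⊕ #K _ _) (cong₂ _+_ (∑ᵇ-⊕ #K _ _) (∑ᵇ-⊕ #K _ _)))
                              (trans (∑ᵇ-⊕ #K _ _) (cong₂ _+_ (∑ᵇ-⊕ #K _ _) (∑ᵇ-⊕ #K _ _))))))
      (trans (∑ᵇ-cong #K λ α → trans
        (cong₂ _+_ (cong₂ _+_ (cong₂ _+_ (at false false false α) (at false false true α)) (cong₂ _+_ (at false true false α) (at false true true α)))
                   (cong₂ _+_ (cong₂ _+_ (at true false false α) (at true false true α)) (cong₂ _+_ (at true true false α) (at true true true α))))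
        (cells-quarter (f₀ α) (f₁ α) (f₂ α) (f₃ α)))
        (∑ᵇ-*ˡ 4 #K _))
      where
      #K : ℕ
      #K = length K
      at : ∀ x′ y′ z′ α → bit (not (S E (x′ ∷ y′ ∷ z′ ∷ α) (tree (suc k)))) ≡ cell (f₀ α) (f₁ α) (f₂ α) (f₃ α) x′ y′ z′
      at x′ y′ z′ α = cong (bit ∘ not) (S-value x′ y′ z′ α)

    odd-quarter : ∀ f a b c → odd (quarter f a b c) ≡ f ∨ a ∨ b
    odd-quarter true  a     b     c     = refl
    odd-quarter false true  b     c     = refl
    odd-quarter false false true  c     = refl
    odd-quarter false false false true  = refl
    odd-quarter false false false false = refl

    -- Write `f ∨ s` as `f + s + f s` with `s = a ∨ b`. The hypothesis, an instance of Jacobi's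
    -- identity, gives `s = q + f c` with `q = a + b + g`; the contributions `f c` of `s` and of
    -- `f s` cancel, so `c` drops out.
    reduce : ∀ f a b c g → b ∧ a ≡ g xor (f ∧ c) → f ∨ a ∨ b ≡ (f xor ((b xor a) xor g)) xor (f ∧ ((b xor a) xor g))
    reduce true  a b c g eq = sym (trans (sym (not-distribˡ-xor q q)) (cong not (xor-same q)))
      where
      q : Bool
      q = (b xor a) xor g
    reduce false a b c g eq rewrite trans (sym (xor-identityʳ g)) (sym eq) = or a b
      where
      or : ∀ a b → a ∨ b ≡ ((b xor a) xor (b ∧ a)) xor false
      or true  true  = refl
      or true  false = refl
      or false true  = refl
      or false false = refl

    S-sep : ∀ α → S K α sep ≡ (f₂ α xor f₁ α) xor f₁₂ α
    S-sep α = trans (S-cong K α λ A → ∨-xor (tree k ((x , z) ∷ A)) (tree k ((x , y) ∷ A)))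
      (trans (S-xor K α _ _) (cong (_xor f₁₂ α) (S-xor K α _ _)))
      where
      ∨-xor : ∀ a b → a ∨ b ≡ (a xor b) xor (a ∧ b)
      ∨-xor true  true  = refl
      ∨-xor true  false = refl
      ∨-xor false b     = sym (xor-identityʳ b)

    module _ (2≤k : 2 ≤ k) (size : suc (length K) ≡ k + k) where

      odd-quarters : odd quarters ≡ splits₂ K (λ A B → tree k A ∧ sep B)
      odd-quarters = begin
        odd quarters
          ≡⟨ odd-∑ᵇ #K _ ⟩
        ∑₂ #K _
          ≡⟨ ∑₂-cong #K (λ α → trans (odd-quarter (f₀ α) (f₁ α) (f₂ α) (f₃ α)) (trans
               (reduce (f₀ α) (f₁ α) (f₂ α) (f₃ α) (f₁₂ α) (jacobi k K α (x , z) (x , y)))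
               (cong (λ q → (f₀ α xor q) xor (f₀ α ∧ q)) (sym (S-sep α))))) ⟩
        ∑₂ #K (λ α → (f₀ α xor S K α sep) xor (f₀ α ∧ S K α sep))
          ≡⟨ trans (∑₂-xor #K _ _) (cong₂ _xor_ (∑₂-xor #K _ _) refl) ⟩
        (∑₂ #K f₀ xor ∑₂ #K (λ α → S K α sep)) xor ∑₂ #K (λ α → f₀ α ∧ S K α sep)
          -- The two linear terms contribute their values at the empty set, which vanish because `k`
          -- is at least 2. In the product, `size` says that a tree and a forest together have
          -- exactly as many edges as `K`.
          ≡⟨ cong₂ _xor_ (cong₂ _xor_ (trans (∑-S K (tree k)) (tree-length k [] (no-tree 0 z≤n)))
               (trans (∑-S K sep) (cong₂ _∨_ (tree-length k _ (no-tree 1 (s≤s z≤n))) (tree-length k _ (no-tree 1 (s≤s z≤n))))))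
               (∑-S*S K (tree k) sep small) ⟩
        splits₂ K (λ A B → tree k A ∧ sep B) ∎
        where
        open ≡-Reasoning
        #K : ℕ
        #K = length K
        no-tree : ∀ m → m ≤ 1 → m ≢ k
        no-tree m m≤1 refl = 1+n≰n (≤-trans 2≤k m≤1)
        sep⇒length : ∀ B → sep B ≡ true → suc (length B) ≡ k
        sep⇒length B s with tree k ((x , z) ∷ B) in eq
        ... | true  = tree⇒length k _ eq
        ... | false = tree⇒length k _ s
        small : ∀ A B → length A + length B < #K → tree k A ∧ sep B ≡ false
        small A B l with tree k A in a | sep B in s
        ... | false | _     = refl
        ... | true  | false = refl
        ... | true  | true  = ⊥-elim (ℕ.<⇒≢ l (suc-injective (trans (trans (sym (+-suc (length A) (length B)))
                (cong₂ _+_ (tree⇒length k A a) (sep⇒length B s))) (sym size))))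

    -- A forest with two components that separates `x`, `y`, `z` separates exactly two of the three
    -- pairs.
    bit-triangle : ∀ a b c → c ≡ a xor b → (bit a + bit b) + bit c ≡ 2 * bit (b ∨ a)
    bit-triangle true  true  c refl = refl
    bit-triangle true  false c refl = refl
    bit-triangle false true  c refl = refl
    bit-triangle false false c refl = refl

    -- One tree has one edge at `zero` and the other has two, in six ways. For a fixed forest the
    -- three choices of the two edges add up to twice its indicator; the choice of the tree that
    -- receives two edges gives the second factor 2.
    treePairs-sep : treePairs (suc k) E ≡ 4 * splits K (λ A B → bit (tree k A) * bit (sep B))
    treePairs-sep = begin
      treePairs (suc k) E
        ≡⟨ cong₂ _+_
             (cong₂ _+_
               (cong₂ _+_ (piece λ A B → trans (cong (deg3 A *_) (deg0 B)) (*-zeroʳ (deg3 A)))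
                          (piece λ A B → cong₂ _*_ (deg2 x y A) (deg1 z B)))
               (cong₂ _+_ (piece λ A B → cong₂ _*_ (deg2 x z A) (deg1 y B))
                          (piece λ A B → cong₂ _*_ (deg1 x A) (deg2 y z B))))
             (cong₂ _+_
               (cong₂ _+_ (piece λ A B → cong₂ _*_ (deg2 y z A) (deg1 x B))
                          (piece λ A B → cong₂ _*_ (deg1 y A) (deg2 x z B)))
               (cong₂ _+_ (piece λ A B → cong₂ _*_ (deg1 z A) (deg2 x y B))
                          (piece λ A B → cong (_* _) (deg0 A)))) ⟩
      ((splits K (λ _ _ → 0) + splits K (λ A B → p x y A * t B)) + (splits K (λ A B → p x z A * t B) + splits K (λ A B → t A * p y z B)))
      + ((splits K (λ A B → p y z A * t B) + splits K (λ A B → t A * p x z B)) + (splits K (λ A B → t A * p x y B) + splits K (λ _ _ → 0)))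
        ≡⟨ cong₂ _+_ (cong₂ _+_ (splits-⊕ K _ _) (splits-⊕ K _ _)) (cong₂ _+_ (splits-⊕ K _ _) (splits-⊕ K _ _)) ⟨
      (splits K _ + splits K _) + (splits K _ + splits K _)
        ≡⟨ cong₂ _+_ (splits-⊕ K _ _) (splits-⊕ K _ _) ⟨
      splits K _ + splits K _
        ≡⟨ splits-⊕ K _ _ ⟨
      splits K (λ A B → ((0 + p x y A * t B) + (p x z A * t B + t A * p y z B)) + ((p y z A * t B + t A * p x z B) + (t A * p x y B + 0)))
        ≡⟨ splits-cong K (λ A B → trans (collect (p x y A) (p x z A) (p y z A) (t A) (p x y B) (p x z B) (p y z B) (t B))
             (cong₂ (λ m n → m * t B + t A * n) (pairs A) (pairs B))) ⟩
      splits K (λ A B → 2 * s A * t B + t A * (2 * s B))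
        ≡⟨ splits-cong K (λ A B → double-both (s A) (t B) (t A) (s B)) ⟩
      splits K (λ A B → 2 * (t B * s A) + 2 * (t A * s B))
        ≡⟨ trans (splits-⊕ K _ _) (cong₂ _+_ (splits-*ˡ 2 K _) (splits-*ˡ 2 K _)) ⟩
      2 * splits K (λ A B → t B * s A) + 2 * splits K (λ A B → t A * s B)
        ≡⟨ cong (λ n → 2 * n + 2 * splits K (λ A B → t A * s B)) (splits-flip K (λ A B → t A * s B)) ⟩
      2 * splits K (λ A B → t A * s B) + 2 * splits K (λ A B → t A * s B)
        ≡⟨ ℕ.*-distribʳ-+ (splits K (λ A B → t A * s B)) 2 2 ⟨
      4 * splits K (λ A B → t A * s B) ∎
      where
      open ≡-Reasoning
      t s : List (Edge (suc k)) → ℕ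
      t A = bit (tree k A)
      s A = bit (sep A)
      p : Fin (suc k) → Fin (suc k) → List (Edge (suc k)) → ℕ
      p u v A = bit (tree k ((u , v) ∷ A))
      piece : ∀ {g h} → (∀ A B → g (map (mapᵉ suc) A) (map (mapᵉ suc) B) ≡ h A B) → splits (map (mapᵉ suc) K) g ≡ splits K h
      piece {g} eq = trans (splits-map (mapᵉ suc) K g) (splits-cong K eq)
      deg0 : ∀ A → bit (tree (suc k) (map (mapᵉ suc) A)) ≡ 0
      deg0 A = cong bit (tree-isolated zero A)
      deg1 : ∀ u A → bit (tree (suc k) ((zero , suc u) ∷ map (mapᵉ suc) A)) ≡ t A
      deg1 u A = cong bit (tree-degree1 zero u A)
      deg2 : ∀ u v A → bit (tree (suc k) ((zero , suc u) ∷ (zero , suc v) ∷ map (mapᵉ suc) A)) ≡ p u v A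
      deg2 u v A = cong bit (tree-degree2 zero u v A)
      deg3 : List (Edge (suc k)) → ℕ
      deg3 A = bit (tree (suc k) ((zero , suc x) ∷ (zero , suc y) ∷ (zero , suc z) ∷ map (mapᵉ suc) A))
      pairs : ∀ A → (p x y A + p x z A) + p y z A ≡ 2 * s A
      pairs A = bit-triangle (tree k ((x , y) ∷ A)) (tree k ((x , z) ∷ A)) _ (tree-triangle k x y z A)
      collect : ∀ a b c t a′ b′ c′ t′ →
        ((0 + a * t′) + (b * t′ + t * c′)) + ((c * t′ + t * b′) + (t * a′ + 0)) ≡ ((a + b) + c) * t′ + t * ((a′ + b′) + c′)
      collect = solve-∀
      double-both : ∀ s t′ t s′ → 2 * s * t′ + t * (2 * s′) ≡ 2 * (t′ * s) + 2 * (t * s′)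
      double-both = solve-∀

  zeros-treePairs : 2 ≤ k → suc (length K) ≡ k + k →
    zeros (suc k) E / 4 % 2 ≡ treePairs (suc k) E / 4 % 2
  zeros-treePairs 2≤k size = begin
    zeros (suc k) E / 4 % 2  ≡⟨ cong (λ n → n / 4 % 2) zeros-quarters ⟩
    4 * quarters / 4 % 2     ≡⟨ cong (_% 2) (4*n/4≡n quarters) ⟩
    quarters % 2             ≡⟨ n%2≡bit quarters ⟩
    bit (odd quarters)       ≡⟨ cong bit (odd-quarters 2≤k size) ⟩
    bit (splits₂ K (λ A B → tree k A ∧ sep B))
      ≡⟨ cong bit (splits₂-cong K (λ A B → trans (cong odd (sym (bit-∧ (tree k A) (sep B)))) (odd-bit _))) ⟨
    bit (splits₂ K (λ A B → odd (bit (tree k A) * bit (sep B)))) ≡⟨ cong bit (odd-splits K _) ⟨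
    bit (odd pairs)          ≡⟨ n%2≡bit pairs ⟨
    pairs % 2                ≡⟨ cong (_% 2) (4*n/4≡n pairs) ⟨
    4 * pairs / 4 % 2        ≡⟨ cong (λ n → n / 4 % 2) treePairs-sep ⟨
    treePairs (suc k) E / 4 % 2 ∎
    where
    open ≡-Reasoning
    4*n/4≡n : ∀ n → 4 * n / 4 ≡ n
    4*n/4≡n n = trans (cong (_/ 4) (ℕ.*-comm 4 n)) (m*n/n≡m n 4)
    pairs : ℕ
    pairs = splits K (λ A B → bit (tree k A) * bit (sep B))

treePairs-length : ∀ k (E : List (Edge (suc k))) → length E ≢ k + k → treePairs k E ≡ 0
treePairs-length k E ne = splits-ε E none
  where
  none : ∀ A B → length A + length B ≡ length E → bit (tree k A) * bit (tree k B) ≡ 0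
  none A B l with tree k A in a | tree k B in b
  ... | false | _     = refl
  ... | true  | false = refl
  ... | true  | true  = contradiction (trans (sym l) (cong₂ _+_ (tree⇒length k A a) (tree⇒length k B b))) ne

treePairs-loop : ∀ k x (E : List (Edge (suc k))) → treePairs k ((x , x) ∷ E) ≡ 0
treePairs-loop k x E = cong₂ _+_
  (splits-ε E λ A B _ → cong (λ b → bit b * bit (tree k B)) (tree-loop k x A))
  (splits-ε E λ A B _ → trans (cong (λ b → bit (tree k A) * bit b) (tree-loop k x B)) (*-zeroʳ (bit (tree k A))))

splits-++ : ∀ (D E : List (Edge k)) g → splits (D ++ E) g ≡ splits E (λ A B → splits D (λ A′ B′ → g (A′ ++ A) (B′ ++ B)))
splits-++ []      E g = refl
splits-++ (e ∷ D) E g = trans (cong₂ _+_ (splits-++ D E _) (splits-++ D E _)) (sym (splits-⊕ E _ _))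

-- Resolving a vertex

-- The terms run over the triples among four points, each joined by a path with two edges: what
-- remains of three edges at a vertex when one of them is contracted.
treeSum : ∀ k (F : List (Edge (suc k))) (x y z u : Fin (suc k)) → ℕ
treeSum k F x y z u = bit (tree k ((x , y) ∷ (x , z) ∷ F)) + bit (tree k ((x , y) ∷ (x , u) ∷ F))
                    + bit (tree k ((x , z) ∷ (x , u) ∷ F)) + bit (tree k ((y , z) ∷ (y , u) ∷ F))

matchingSum : ∀ k (F : List (Edge (suc k))) (x y z u : Fin (suc k)) → ℕ
matchingSum k F x y z u = bit (tree k ((x , y) ∷ (z , u) ∷ F)) + bit (tree k ((x , z) ∷ (y , u) ∷ F))
                        + bit (tree k ((x , u) ∷ (y , z) ∷ F))

four-points-Fin3 : ∀ x y z u → treeSum 2 [] x y z u ≡ matchingSum 2 [] x y z u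
four-points-Fin3 = from-yes (all? λ x → all? λ y → all? λ z → all? λ u → treeSum 2 [] x y z u ℕ.≟ matchingSum 2 [] x y z u)

-- With `F` contracted, two edges form a spanning tree only on three vertices. If the four points
-- meet all three, exactly one pair coincides; the two triples that omit one of its points and the
-- two matchings that separate it are trees. Otherwise both sides are 0.
four-points : ∀ k (F : List (Edge (suc k))) x y z u → treeSum k F x y z u ≡ matchingSum k F x y z u
four-points k F x y z u with contraction k F
... | cyclic h = trans (cong₂ _+_ (cong₂ _+_ (cong₂ _+_ (none (_ ∷ _ ∷ [])) (none (_ ∷ _ ∷ []))) (none (_ ∷ _ ∷ []))) (none (_ ∷ _ ∷ [])))
                       (sym (cong₂ _+_ (cong₂ _+_ (none (_ ∷ _ ∷ [])) (none (_ ∷ _ ∷ []))) (none (_ ∷ _ ∷ []))))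
  where
  none : ∀ A → bit (tree k (A ++ F)) ≡ 0
  none A = cong bit (h A)
... | acyclic r φ _ h = trans (cong₂ _+_ (cong₂ _+_ (cong₂ _+_ (same (_ ∷ _ ∷ [])) (same (_ ∷ _ ∷ []))) (same (_ ∷ _ ∷ []))) (same (_ ∷ _ ∷ [])))
                       (trans (small r φ) (sym (cong₂ _+_ (cong₂ _+_ (same (_ ∷ _ ∷ [])) (same (_ ∷ _ ∷ []))) (same (_ ∷ _ ∷ [])))))
  where
  same : ∀ A → bit (tree k (A ++ F)) ≡ bit (tree r (map (mapᵉ φ) A))
  same A = cong bit (h A)
  small : ∀ r (φ : Fin (suc k) → Fin (suc r)) → treeSum r [] (φ x) (φ y) (φ z) (φ u) ≡ matchingSum r [] (φ x) (φ y) (φ z) (φ u)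
  small r φ with r ℕ.≟ 2
  ... | yes refl = four-points-Fin3 (φ x) (φ y) (φ z) (φ u)
  ... | no r≢2 = trans (cong₂ _+_ (cong₂ _+_ (cong₂ _+_ (none _ _) (none _ _)) (none _ _)) (none _ _))
                       (sym (cong₂ _+_ (cong₂ _+_ (none _ _) (none _ _)) (none _ _)))
    where
    none : ∀ e f → bit (tree r (e ∷ f ∷ [])) ≡ 0
    none e f = cong bit (tree-length r (e ∷ f ∷ []) (r≢2 ∘ sym))

spokes : Fin (2 + k) → List (Fin (1 + k)) → List (Edge (2 + k))
spokes x = map (λ y → x , punchIn x y)

module _ (k : ℕ) (x : Fin (2 + k)) (W : List (Edge (1 + k))) where

  private
    π : List (Edge (1 + k)) → List (Edge (2 + k))
    π = map (mapᵉ (punchIn x))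

    t : List (Edge (1 + k)) → ℕ
    t A = bit (tree k A)

    t⁺ : List (Edge (2 + k)) → ℕ
    t⁺ A = bit (tree (suc k) A)

    local : List (Fin (1 + k)) → List (Edge (1 + k)) → List (Edge (1 + k)) → ℕ
    local ys A B = splits (spokes x ys) (λ A′ B′ → t⁺ (A′ ++ π A) * t⁺ (B′ ++ π B))

    resolved : List (Edge (1 + k)) → List (Edge (1 + k)) → List (Edge (1 + k)) → ℕ
    resolved D A B = splits D (λ A′ B′ → t (A′ ++ A) * t (B′ ++ B))

    star-local : ∀ ys → treePairs (suc k) (spokes x ys ++ π W) ≡ splits W (local ys)
    star-local ys = trans (splits-++ (spokes x ys) (π W) _) (splits-map (mapᵉ (punchIn x)) W _)

    resolved-local : ∀ D → treePairs k (D ++ W) ≡ splits W (resolved D)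
    resolved-local D = splits-++ D W _

    t0 : ∀ A → t⁺ (π A) ≡ 0
    t0 A = cong bit (tree-isolated x A)

    t1 : ∀ y A → t⁺ (spokes x (y ∷ []) ++ π A) ≡ t A
    t1 y A = cong bit (tree-degree1 x y A)

    t2 : ∀ y z A → t⁺ (spokes x (y ∷ z ∷ []) ++ π A) ≡ t ((y , z) ∷ A)
    t2 y z A = cong bit (tree-degree2 x y z A)

    t3 : ∀ y z u A → t⁺ (spokes x (y ∷ z ∷ u ∷ []) ++ π A) ≡ t ((y , z) ∷ (y , u) ∷ A)
    t3 y z u A = cong bit (tree-degree3 x y z u A)

    *0 : ∀ {n} a → n ≡ 0 → a * n ≡ 0
    *0 a refl = *-zeroʳ a

  -- Fewer than four edges at the resolved vertex occur when some of its edges lead to the deleted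
  -- terminal.
  resolve0 : treePairs (suc k) (π W) ≡ 0
  resolve0 = trans (star-local []) (splits-ε W λ A B _ → cong (_* t⁺ (π B)) (t0 A))

  resolve1 : ∀ y → treePairs (suc k) (spokes x (y ∷ []) ++ π W) ≡ 0
  resolve1 y = trans (star-local (y ∷ [])) (splits-ε W λ A B _ →
    cong₂ _+_ (*0 (t⁺ (spokes x (y ∷ []) ++ π A)) (t0 B)) (cong (_* t⁺ (spokes x (y ∷ []) ++ π B)) (t0 A)))

  resolve2 : ∀ y z → treePairs (suc k) (spokes x (y ∷ z ∷ []) ++ π W) ≡ treePairs k W + treePairs k W
  resolve2 y z = trans (star-local (y ∷ z ∷ [])) (trans (splits-cong W λ A B →
      cong₂ _+_ (cong₂ _+_ (*0 (t⁺ (spokes x (y ∷ z ∷ []) ++ π A)) (t0 B)) (cong₂ _*_ (t1 y A) (t1 z B)))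
                (trans (cong₂ _+_ (cong₂ _*_ (t1 z A) (t1 y B)) (cong (_* t⁺ (spokes x (y ∷ z ∷ []) ++ π B)) (t0 A))) (+-identityʳ _)))
    (splits-⊕ W _ _))

  resolve3 : ∀ y z u → treePairs (suc k) (spokes x (y ∷ z ∷ u ∷ []) ++ π W) ≡
    treePairs k ((z , u) ∷ W) + treePairs k ((y , u) ∷ W) + treePairs k ((y , z) ∷ W)
  resolve3 y z u = trans (star-local (y ∷ z ∷ u ∷ [])) (trans (splits-cong W λ A B → trans
      (cong₂ _+_
        (cong₂ _+_
          (cong₂ _+_ (*0 (t⁺ (spokes x (y ∷ z ∷ u ∷ []) ++ π A)) (t0 B)) (cong₂ _*_ (t2 y z A) (t1 u B)))
          (cong₂ _+_ (cong₂ _*_ (t2 y u A) (t1 z B)) (cong₂ _*_ (t1 y A) (t2 z u B))))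
        (cong₂ _+_
          (cong₂ _+_ (cong₂ _*_ (t2 z u A) (t1 y B)) (cong₂ _*_ (t1 z A) (t2 y u B)))
          (cong₂ _+_ (cong₂ _*_ (t1 u A) (t2 y z B)) (cong (_* t⁺ (spokes x (y ∷ z ∷ u ∷ []) ++ π B)) (t0 A)))))
      (arrange (t ((y , z) ∷ A) * t B) (t ((y , u) ∷ A) * t B) (t A * t ((z , u) ∷ B))
               (t ((z , u) ∷ A) * t B) (t A * t ((y , u) ∷ B)) (t A * t ((y , z) ∷ B))))
    (trans (splits-⊕ W _ _) (cong₂ _+_ (trans (splits-⊕ W _ _) (cong₂ _+_
      (sym (resolved-local ((z , u) ∷ []))) (sym (resolved-local ((y , u) ∷ []))))) (sym (resolved-local ((y , z) ∷ []))))))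
    where
    arrange : ∀ a b c d e f → (0 + a + (b + c)) + ((d + e) + (f + 0)) ≡ (d + c) + (b + e) + (a + f)
    arrange = solve-∀

  -- Of the sixteen distributions of the four edges, the two of type 4 + 0 give nothing. The six of
  -- type 2 + 2 are the terms on the right with the two new edges in different trees. The eight of
  -- type 3 + 1 yield the terms with both new edges in one tree, but only in total, by `four-points`
  -- for each of the trees.
  resolve4 : ∀ y z u v → treePairs (suc k) (spokes x (y ∷ z ∷ u ∷ v ∷ []) ++ π W) ≡
    treePairs k ((y , z) ∷ (u , v) ∷ W) + treePairs k ((y , u) ∷ (z , v) ∷ W) + treePairs k ((y , v) ∷ (z , u) ∷ W)
  resolve4 y z u v = trans (star-local (y ∷ z ∷ u ∷ v ∷ [])) (trans (splits-cong W λ A B → trans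
      (cong₂ _+_
        (cong₂ _+_
          (cong₂ _+_
            (cong₂ _+_ (*0 (t⁺ (spokes x (y ∷ z ∷ u ∷ v ∷ []) ++ π A)) (t0 B)) (cong₂ _*_ (t3 y z u A) (t1 v B)))
            (cong₂ _+_ (cong₂ _*_ (t3 y z v A) (t1 u B)) (cong₂ _*_ (t2 y z A) (t2 u v B))))
          (cong₂ _+_
            (cong₂ _+_ (cong₂ _*_ (t3 y u v A) (t1 z B)) (cong₂ _*_ (t2 y u A) (t2 z v B)))
            (cong₂ _+_ (cong₂ _*_ (t2 y v A) (t2 z u B)) (cong₂ _*_ (t1 y A) (t3 z u v B)))))
        (cong₂ _+_
          (cong₂ _+_
            (cong₂ _+_ (cong₂ _*_ (t3 z u v A) (t1 y B)) (cong₂ _*_ (t2 z u A) (t2 y v B)))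
            (cong₂ _+_ (cong₂ _*_ (t2 z v A) (t2 y u B)) (cong₂ _*_ (t1 z A) (t3 y u v B))))
          (cong₂ _+_
            (cong₂ _+_ (cong₂ _*_ (t2 u v A) (t2 y z B)) (cong₂ _*_ (t1 u A) (t3 y z v B)))
            (cong₂ _+_ (cong₂ _*_ (t1 v A) (t3 y z u B)) (cong (_* t⁺ (spokes x (y ∷ z ∷ u ∷ v ∷ []) ++ π B)) (t0 A))))))
      (arrange (t A) (t B)
        (t ((y , z) ∷ A) * t ((u , v) ∷ B)) (t ((y , u) ∷ A) * t ((z , v) ∷ B)) (t ((y , v) ∷ A) * t ((z , u) ∷ B))
        (t ((z , u) ∷ A) * t ((y , v) ∷ B)) (t ((z , v) ∷ A) * t ((y , u) ∷ B)) (t ((u , v) ∷ A) * t ((y , z) ∷ B))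
        (t ((y , z) ∷ (y , u) ∷ A)) (t ((y , z) ∷ (y , v) ∷ A)) (t ((y , u) ∷ (y , v) ∷ A)) (t ((z , u) ∷ (z , v) ∷ A))
        (t ((y , z) ∷ (y , u) ∷ B)) (t ((y , z) ∷ (y , v) ∷ B)) (t ((y , u) ∷ (y , v) ∷ B)) (t ((z , u) ∷ (z , v) ∷ B))
        (t ((y , z) ∷ (u , v) ∷ A)) (t ((y , u) ∷ (z , v) ∷ A)) (t ((y , v) ∷ (z , u) ∷ A))
        (t ((y , z) ∷ (u , v) ∷ B)) (t ((y , u) ∷ (z , v) ∷ B)) (t ((y , v) ∷ (z , u) ∷ B))
        (four-points k A y z u v) (four-points k B y z u v)))
    (trans (splits-⊕ W _ _) (cong₂ _+_ (trans (splits-⊕ W _ _) (cong₂ _+_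
      (sym (resolved-local ((y , z) ∷ (u , v) ∷ []))) (sym (resolved-local ((y , u) ∷ (z , v) ∷ [])))))
      (sym (resolved-local ((y , v) ∷ (z , u) ∷ []))))))
    where
    arrange : ∀ a b m₁ m₂ m₃ m₄ m₅ m₆ p₁ p₂ p₃ p₄ q₁ q₂ q₃ q₄ r₁ r₂ r₃ s₁ s₂ s₃ →
      p₁ + p₂ + p₃ + p₄ ≡ r₁ + r₂ + r₃ → q₁ + q₂ + q₃ + q₄ ≡ s₁ + s₂ + s₃ →
      (((0 + p₁ * b) + (p₂ * b + m₁)) + ((p₃ * b + m₂) + (m₃ + a * q₄)))
      + (((p₄ * b + m₄) + (m₅ + a * q₃)) + ((m₆ + a * q₂) + (a * q₁ + 0)))
      ≡ (((r₁ * b + m₁) + (m₆ + a * s₁)) + ((r₂ * b + m₂) + (m₅ + a * s₂))) + ((r₃ * b + m₃) + (m₄ + a * s₃))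
    arrange a b m₁ m₂ m₃ m₄ m₅ m₆ p₁ p₂ p₃ p₄ q₁ q₂ q₃ q₄ r₁ r₂ r₃ s₁ s₂ s₃ p q = trans
      (collect a b m₁ m₂ m₃ m₄ m₅ m₆ p₁ p₂ p₃ p₄ q₁ q₂ q₃ q₄)
      (trans (cong₂ (λ P Q → P * b + a * Q + (m₁ + m₂ + m₃ + m₄ + m₅ + m₆)) p q)
             (spread a b m₁ m₂ m₃ m₄ m₅ m₆ r₁ r₂ r₃ s₁ s₂ s₃))
      where
      collect : ∀ a b m₁ m₂ m₃ m₄ m₅ m₆ p₁ p₂ p₃ p₄ q₁ q₂ q₃ q₄ →
        (((0 + p₁ * b) + (p₂ * b + m₁)) + ((p₃ * b + m₂) + (m₃ + a * q₄)))
        + (((p₄ * b + m₄) + (m₅ + a * q₃)) + ((m₆ + a * q₂) + (a * q₁ + 0)))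
        ≡ (p₁ + p₂ + p₃ + p₄) * b + a * (q₁ + q₂ + q₃ + q₄) + (m₁ + m₂ + m₃ + m₄ + m₅ + m₆)
      collect = solve-∀
      spread : ∀ a b m₁ m₂ m₃ m₄ m₅ m₆ r₁ r₂ r₃ s₁ s₂ s₃ →
        (r₁ + r₂ + r₃) * b + a * (s₁ + s₂ + s₃) + (m₁ + m₂ + m₃ + m₄ + m₅ + m₆)
        ≡ (((r₁ * b + m₁) + (m₆ + a * s₁)) + ((r₂ * b + m₂) + (m₅ + a * s₂))) + ((r₃ * b + m₃) + (m₄ + a * s₃))
      spread = solve-∀

-- Degrees and deletion of a terminal

degᵉ : Fin k → Edge k → ℕ
degᵉ z (x , y) = bit (x == z) + bit (y == z)

deg : Fin k → List (Edge k) → ℕ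
deg z []      = 0
deg z (e ∷ E) = degᵉ z e + deg z E

deg-≋ : ∀ (z : Fin k) → Invariant (deg z)
deg-≋ z nil                 = refl
deg-≋ z (keep e p)          = cong (degᵉ z e +_) (deg-≋ z p)
deg-≋ z (turn x y A)        = cong (_+ deg z A) (+-comm (bit (x == z)) (bit (y == z)))
deg-≋ z (exchange e f A)    = swap-sum (degᵉ z e) (degᵉ z f) (deg z A)
  where
  swap-sum : ∀ a b c → a + (b + c) ≡ b + (a + c)
  swap-sum = solve-∀
deg-≋ z (≋-trans p q)       = trans (deg-≋ z p) (deg-≋ z q)

degᵉ-self : ∀ (x y : Fin k) → y ≢ x → degᵉ x (x , y) ≡ 1
degᵉ-self x y ne = cong₂ (λ a b → bit a + bit b) (==-refl x) (≢⇒== ne)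

degᵉ-other : ∀ {x y z : Fin k} → x ≢ z → y ≢ z → degᵉ z (x , y) ≡ 0
degᵉ-other ne ne′ = cong₂ (λ a b → bit a + bit b) (≢⇒== ne) (≢⇒== ne′)

-- A loop is a case of its own: it makes the counts zero or is excluded, and without one the degree
-- of `x` is the number of its spokes.
data Star (x : Fin (2 + k)) (E : List (Edge (2 + k))) : Set where
  hasLoop : ∀ E′ → E ≋ (x , x) ∷ E′ → Star x E
  star : ∀ ys E′ → E ≋ spokes x ys ++ map (mapᵉ (punchIn x)) E′ → length ys ≡ deg x E → Star x E

star-at : ∀ (x : Fin (2 + k)) E → Star x E
star-at x [] = star [] [] nil refl
star-at x ((a , b) ∷ E) with star-at x E
... | hasLoop E′ p = hasLoop ((a , b) ∷ E′) (≋-trans (keep _ p) (exchange _ _ _))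
... | star ys E′ p l = cases (a ≟ x) (b ≟ x)
  where
  cases : Dec (a ≡ x) → Dec (b ≡ x) → Star x ((a , b) ∷ E)
  cases (yes refl) (yes refl) = hasLoop E ≋-refl
  cases (yes refl) (no b≢x)   = star (remove x b ∷ ys) E′
    (≋-trans (keep _ p) (≋-reflexive (cong (λ c → (x , c) ∷ _) (sym (punchIn-remove x b≢x)))))
    (cong₂ _+_ (sym (degᵉ-self x b b≢x)) l)
  cases (no a≢x)   (yes refl) = star (remove x a ∷ ys) E′
    (≋-trans (≋-trans (turn a x E) (keep _ p)) (≋-reflexive (cong (λ c → (x , c) ∷ _) (sym (punchIn-remove x a≢x)))))
    (cong₂ _+_ (sym (trans (+-comm (bit (a == x)) (bit (x == x))) (degᵉ-self x a a≢x))) l)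
  cases (no a≢x)   (no b≢x)   = star ys ((remove x a , remove x b) ∷ E′)
    (≋-trans (keep _ p) (≋-trans (≋-sym (≋-shift _ (spokes x ys) _))
      (≋-++ˡ (spokes x ys) (≋-reflexive (cong₂ (λ c d → (c , d) ∷ _) (sym (punchIn-remove x a≢x)) (sym (punchIn-remove x b≢x)))))))
    (cong₂ _+_ (sym (degᵉ-other a≢x b≢x)) l)

touches : Fin k → Edge k → Bool
touches z (x , y) = (x == z) ∨ (y == z)

side : Fin (2 + m) → Fin (1 + m)
side zero    = zero
side (suc x) = x

-- For z ∈ {0 , 1}: deletes z and renumbers so that the other terminal becomes 0.
without : Fin (2 + m) → List (Edge (2 + m)) → List (Edge (1 + m))
without z []      = []
without z (e ∷ E) = if touches z e then without z E else mapᵉ side e ∷ without z E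

without-hit : ∀ (z : Fin (2 + m)) e E → touches z e ≡ true → without z (e ∷ E) ≡ without z E
without-hit z e E eq rewrite eq = refl

without-miss : ∀ (z : Fin (2 + m)) e E → touches z e ≡ false → without z (e ∷ E) ≡ mapᵉ side e ∷ without z E
without-miss z e E eq rewrite eq = refl

without-≋ : ∀ (z : Fin (2 + m)) {E E′} → E ≋ E′ → without z E ≋ without z E′
without-≋ z nil = nil
without-≋ z (keep e p) with touches z e
... | true  = without-≋ z p
... | false = keep _ (without-≋ z p)
without-≋ z (turn x y A) rewrite ∨-comm (x == z) (y == z) with (y == z) ∨ (x == z)
... | true  = ≋-refl
... | false = turn _ _ _
without-≋ z (exchange e f A) with touches z e | touches z f
... | true  | true  = ≋-refl
... | true  | false = ≋-refl
... | false | true  = ≋-refl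
... | false | false = exchange _ _ _
without-≋ z (≋-trans p q) = ≋-trans (without-≋ z p) (without-≋ z q)

τ : Fin (2 + m) → List (Edge (2 + m)) → ℕ
τ {m} z E = treePairs m (without z E)

τ-≋ : ∀ (z : Fin (2 + m)) → Invariant (τ z)
τ-≋ {m} z p = treePairs-≋ m (without-≋ z p)

touches-self : ∀ (z y : Fin k) → touches z (z , y) ≡ true
touches-self z y = cong (_∨ (y == z)) (==-refl z)

touches-other : ∀ {x y z : Fin k} → x ≢ z → y ≢ z → touches z (x , y) ≡ false
touches-other ne ne′ = cong₂ _∨_ (≢⇒== ne) (≢⇒== ne′)

length-without : ∀ (z : Fin (2 + m)) E → length E ≤ length (without z E) + deg z E
length-without z []            = z≤n
length-without z ((x , y) ∷ E) with x == z | y == z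
... | true  | b     = ≤-trans (s≤s (length-without z E)) (≤-trans (≤-reflexive (sym (+-suc (length (without z E)) (deg z E))))
                        (ℕ.+-monoʳ-≤ (length (without z E)) (s≤s (ℕ.m≤n+m (deg z E) (bit b)))))
... | false | true  = ≤-trans (s≤s (length-without z E)) (≤-reflexive (sym (+-suc (length (without z E)) (deg z E))))
... | false | false = s≤s (length-without z E)

Regular : List (Edge k) → Set
Regular E = ∀ z → deg z E ≡ 4

Regular-≋ : ∀ {E E′ : List (Edge k)} → E ≋ E′ → Regular E → Regular E′
Regular-≋ p r z = trans (sym (deg-≋ z p)) (r z)

-- Deleting z removes at most three edges if one of the edges at z is a loop.
τ-loop : ∀ (z a : Fin (2 + m)) E → Regular ((a , a) ∷ E) → length ((a , a) ∷ E) ≡ 4 + (m + m) → τ z ((a , a) ∷ E) ≡ 0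
τ-loop {m} z a E r l = cases (a ≟ z)
  where
  cases : Dec (a ≡ z) → τ z ((a , a) ∷ E) ≡ 0
  cases (no a≢z)   = trans (cong (treePairs m) (without-miss z (a , a) E (touches-other a≢z a≢z))) (treePairs-loop m (side a) (without z E))
  cases (yes refl) = trans (cong (treePairs m) (without-hit z (z , z) E (touches-self z z))) (treePairs-length m (without z E) too-long)
    where
    deg≡2 : deg z E ≡ 2
    deg≡2 = suc-injective (suc-injective (trans (cong (λ b → (bit b + bit b) + deg z E) (sym (==-refl z))) (r z)))
    too-long : length (without z E) ≢ m + m
    too-long eq = 1+n≰n (≤-trans (≤-reflexive (sym (suc-injective l))) (≤-trans (length-without z E)
      (≤-reflexive (trans (cong₂ _+_ eq deg≡2) (+-comm (m + m) 2)))))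

-- The vertex resolved next. Its removal leaves the numbers 0 and 1 of the terminals unchanged.
two : Fin (3 + m)
two = suc (suc zero)

terminal : Fin 2 → Fin (2 + m)
terminal zero    = zero
terminal (suc _) = suc zero

two≢terminal : ∀ b → two {m} ≢ terminal b
two≢terminal zero    ()
two≢terminal (suc _) ()

punchIn-terminal : ∀ b → punchIn (two {m}) (terminal b) ≡ terminal b
punchIn-terminal zero    = refl
punchIn-terminal (suc _) = refl

==-terminal : ∀ b (y : Fin (2 + m)) → (punchIn two y == terminal b) ≡ (y == terminal b)
==-terminal b y = trans (cong (punchIn two y ==_) (sym (punchIn-terminal b)))
  (==-injective (punchIn two) (punchIn-injective two _ _) y (terminal b))

side-punchIn : ∀ (y : Fin (2 + m)) → side (punchIn two y) ≡ punchIn (suc zero) (side y)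
side-punchIn zero    = refl
side-punchIn (suc y) = refl

without-punchIn : ∀ b (E : List (Edge (2 + m))) →
  without (terminal b) (map (mapᵉ (punchIn two)) E) ≡ map (mapᵉ (punchIn (suc zero))) (without (terminal b) E)
without-punchIn b [] = refl
without-punchIn b ((x , y) ∷ E) rewrite ==-terminal b x | ==-terminal b y with (x == terminal b) ∨ (y == terminal b)
... | true  = without-punchIn b E
... | false = cong₂ _∷_ (cong₂ _,_ (side-punchIn x) (side-punchIn y)) (without-punchIn b E)

-- Resolution when neighbours may be the deleted terminal

module _ (b : Fin 2) (E : List (Edge (2 + m))) (size : 2 + length E ≡ 4 + (m + m)) where

  private
    T : Fin (2 + m)
    T = terminal b

    W : List (Edge (1 + m))
    W = without T E

    around : List (Fin (2 + m)) → List (Edge (3 + m))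
    around ys = spokes two ys ++ map (mapᵉ (punchIn two)) E

    τ⁺ : List (Fin (2 + m)) → ℕ
    τ⁺ ys = τ (terminal b) (around ys)

    inner : List (Fin (2 + m)) → List (Edge (2 + m))
    inner ys = without (terminal b) (around ys)

    spoke-hit : ∀ ys → inner (T ∷ ys) ≡ inner ys
    spoke-hit ys = without-hit (terminal b) (two , punchIn two T) (around ys)
      (trans (cong ((two == terminal b) ∨_) (trans (==-terminal b T) (==-refl T))) (∨-zeroʳ (two == terminal b)))

    spoke-miss : ∀ y ys {us} → y ≢ T → inner ys ≡ us → inner (y ∷ ys) ≡ (suc zero , punchIn (suc zero) (side y)) ∷ us
    spoke-miss y ys ne eq = trans (without-miss (terminal b) (two , punchIn two y) (around ys)
      (cong₂ _∨_ (≢⇒== (two≢terminal b)) (trans (==-terminal b y) (≢⇒== ne))))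
      (cong₂ (λ c us → (suc zero , c) ∷ us) (side-punchIn y) eq)

    spoke-none : inner [] ≡ map (mapᵉ (punchIn (suc zero))) W
    spoke-none = without-punchIn b E

    hitˡ : ∀ y e → without T ((T , y) ∷ e) ≡ without T e
    hitˡ y e = without-hit T (T , y) e (touches-self T y)

    miss : ∀ x y e {us} → x ≢ T → y ≢ T → without T e ≡ us → without T ((x , y) ∷ e) ≡ (side x , side y) ∷ us
    miss x y e p q eq = trans (without-miss T (x , y) e (touches-other p q)) (cong (_ ∷_) eq)

    -- Regularity is a premise because `T` occurring twice among the neighbours produces a loop at
    -- `T`, which is dealt with by counting edges.
    Resolution : (x y z u : Fin (2 + m)) → Set
    Resolution x y z u = Regular ((x , y) ∷ (z , u) ∷ E) → τ⁺ (x ∷ y ∷ z ∷ u ∷ []) ≡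
      τ T ((x , y) ∷ (z , u) ∷ E) + τ T ((x , z) ∷ (y , u) ∷ E) + τ T ((x , u) ∷ (y , z) ∷ E)

    last-two : ∀ p q r → p + q + r ≡ p + r + q
    last-two = solve-∀

    -- Both sides are symmetric in the four neighbours. The three swaps generate all permutations,
    -- so it suffices to treat one position for each number of neighbours equal to `T`.
    swap₁₂ : ∀ {x y z u} → Resolution y x z u → Resolution x y z u
    swap₁₂ {x} {y} {z} {u} h r = trans (τ-≋ (terminal b) swapped) (trans (h (Regular-≋ (turn x y ((z , u) ∷ E)) r))
      (trans (cong₂ _+_ (cong₂ _+_ (τ-≋ T (turn y x ((z , u) ∷ E))) (τ-≋ T (exchange (y , z) (x , u) E))) (τ-≋ T (exchange (y , u) (x , z) E)))
             (last-two (τ T ((x , y) ∷ (z , u) ∷ E)) _ _)))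
      where
      swapped : around (x ∷ y ∷ z ∷ u ∷ []) ≋ around (y ∷ x ∷ z ∷ u ∷ [])
      swapped = exchange _ _ _

    swap₂₃ : ∀ {x y z u} → Resolution x z y u → Resolution x y z u
    swap₂₃ {x} {y} {z} {u} h r = trans (τ-≋ (terminal b) swapped) (trans (h (λ q → trans (pair q) (r q)))
      (cong₂ _+_ (+-comm (τ T ((x , z) ∷ (y , u) ∷ E)) _) (τ-≋ T (keep (x , u) (turn z y E)))))
      where
      swapped : around (x ∷ y ∷ z ∷ u ∷ []) ≋ around (x ∷ z ∷ y ∷ u ∷ [])
      swapped = keep _ (exchange _ _ _)
      pair : ∀ q → deg q ((x , z) ∷ (y , u) ∷ E) ≡ deg q ((x , y) ∷ (z , u) ∷ E)
      pair q = rearrange (bit (x == q)) (bit (y == q)) (bit (z == q)) (bit (u == q)) (deg q E)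
        where
        rearrange : ∀ a b c d e → (a + c) + ((b + d) + e) ≡ (a + b) + ((c + d) + e)
        rearrange = solve-∀

    swap₃₄ : ∀ {x y z u} → Resolution x y u z → Resolution x y z u
    swap₃₄ {x} {y} {z} {u} h r = trans (τ-≋ (terminal b) swapped) (trans (h (Regular-≋ (keep (x , y) (turn z u E)) r))
      (trans (cong (λ n → n + τ T ((x , u) ∷ (y , z) ∷ E) + τ T ((x , z) ∷ (y , u) ∷ E)) (τ-≋ T (keep (x , y) (turn u z E))))
             (last-two (τ T ((x , y) ∷ (z , u) ∷ E)) _ _)))
      where
      swapped : around (x ∷ y ∷ z ∷ u ∷ []) ≋ around (x ∷ y ∷ u ∷ z ∷ [])
      swapped = keep _ (keep _ (exchange _ _ _))

    none : ∀ {x y z u} → x ≢ T → y ≢ T → z ≢ T → u ≢ T → Resolution x y z u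
    none {x} {y} {z} {u} p q r s _ = trans
      (cong (treePairs (suc m)) (spoke-miss x (y ∷ z ∷ u ∷ []) p (spoke-miss y (z ∷ u ∷ []) q (spoke-miss z (u ∷ []) r (spoke-miss u [] s spoke-none)))))
      (trans (resolve4 m (suc zero) W (side x) (side y) (side z) (side u))
        (sym (cong₂ _+_ (cong₂ _+_ (cong (treePairs m) (miss x y ((z , u) ∷ E) p q (miss z u E r s refl))) (cong (treePairs m) (miss x z ((y , u) ∷ E) p r (miss y u E q s refl))))
                        (cong (treePairs m) (miss x u ((y , z) ∷ E) p s (miss y z E q r refl))))))

    one₁ : ∀ {x y z u} → x ≡ T → y ≢ T → z ≢ T → u ≢ T → Resolution x y z u
    one₁ {x} {y} {z} {u} refl q r s _ = trans
      (cong (treePairs (suc m)) (trans (spoke-hit (y ∷ z ∷ u ∷ [])) (spoke-miss y (z ∷ u ∷ []) q (spoke-miss z (u ∷ []) r (spoke-miss u [] s spoke-none)))))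
      (trans (resolve3 m (suc zero) W (side y) (side z) (side u))
        (sym (cong₂ _+_ (cong₂ _+_ (cong (treePairs m) (trans (hitˡ y ((z , u) ∷ E)) (miss z u E r s refl))) (cong (treePairs m) (trans (hitˡ z ((y , u) ∷ E)) (miss y u E q s refl))))
                        (cong (treePairs m) (trans (hitˡ u ((y , z) ∷ E)) (miss y z E q r refl))))))

    one₂ : ∀ {x y z u} → x ≢ T → y ≡ T → z ≢ T → u ≢ T → Resolution x y z u
    one₂ p q r s = swap₁₂ (one₁ q p r s)

    one₃ : ∀ {x y z u} → x ≢ T → y ≢ T → z ≡ T → u ≢ T → Resolution x y z u
    one₃ p q r s = swap₂₃ (one₂ p r q s)

    one₄ : ∀ {x y z u} → x ≢ T → y ≢ T → z ≢ T → u ≡ T → Resolution x y z u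
    one₄ p q r s = swap₃₄ (one₃ p q s r)

    -- The pairing of the two copies of `T` has a loop and counts 0. The other two pairings lose
    -- both new edges together with `T`, and each gives one summand of `resolve2`.
    two₁₂ : ∀ {x y z u} → x ≡ T → y ≡ T → z ≢ T → u ≢ T → Resolution x y z u
    two₁₂ {x} {y} {z} {u} refl refl r s reg = trans
      (cong (treePairs (suc m)) (trans (spoke-hit (T ∷ z ∷ u ∷ [])) (trans (spoke-hit (z ∷ u ∷ [])) (spoke-miss z (u ∷ []) r (spoke-miss u [] s spoke-none)))))
      (trans (resolve2 m (suc zero) W (side z) (side u))
        (sym (cong₂ _+_ (cong₂ _+_ (τ-loop T T ((z , u) ∷ E) reg size) (cong (treePairs m) (trans (hitˡ z ((T , u) ∷ E)) (hitˡ u E))))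
                        (cong (treePairs m) (trans (hitˡ u ((T , z) ∷ E)) (hitˡ z E))))))

    two₁₃ : ∀ {x y z u} → x ≡ T → y ≢ T → z ≡ T → u ≢ T → Resolution x y z u
    two₁₃ p q r s = swap₂₃ (two₁₂ p r q s)

    two₁₄ : ∀ {x y z u} → x ≡ T → y ≢ T → z ≢ T → u ≡ T → Resolution x y z u
    two₁₄ p q r s = swap₃₄ (two₁₃ p q s r)

    two₂₃ : ∀ {x y z u} → x ≢ T → y ≡ T → z ≡ T → u ≢ T → Resolution x y z u
    two₂₃ p q r s = swap₁₂ (two₁₃ q p r s)

    two₂₄ : ∀ {x y z u} → x ≢ T → y ≡ T → z ≢ T → u ≡ T → Resolution x y z u
    two₂₄ p q r s = swap₁₂ (two₁₄ q p r s)

    two₃₄ : ∀ {x y z u} → x ≢ T → y ≢ T → z ≡ T → u ≡ T → Resolution x y z u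
    two₃₄ p q r s = swap₂₃ (two₂₄ p r q s)

    -- Every pairing contains a loop at `T`; on the left the resolved vertex keeps at most one edge,
    -- too few for two trees.
    three₁₂₃ : ∀ {x y z u} → x ≡ T → y ≡ T → z ≡ T → Resolution x y z u
    three₁₂₃ {x} {y} {z} {u} refl refl refl reg = trans
      (cong (treePairs (suc m)) (trans (spoke-hit (T ∷ T ∷ u ∷ [])) (trans (spoke-hit (T ∷ u ∷ [])) (spoke-hit (u ∷ [])))))
      (trans (last (u ≟ T)) (sym (cong₂ _+_ (cong₂ _+_ T-loop T-loop)
        (trans (τ-≋ T (exchange (T , u) (T , T) E)) T-loop))))
      where
      T-loop : τ T ((T , T) ∷ (T , u) ∷ E) ≡ 0
      T-loop = τ-loop T T ((T , u) ∷ E) reg size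
      last : Dec (u ≡ T) → treePairs (suc m) (inner (u ∷ [])) ≡ 0
      last (yes refl) = trans (cong (treePairs (suc m)) (trans (spoke-hit []) spoke-none)) (resolve0 m (suc zero) W)
      last (no  s)    = trans (cong (treePairs (suc m)) (spoke-miss u [] s spoke-none)) (resolve1 m (suc zero) W (side u))

    three₁₂₄ : ∀ {x y z u} → x ≡ T → y ≡ T → u ≡ T → Resolution x y z u
    three₁₂₄ p q s = swap₃₄ (three₁₂₃ p q s)

    three₁₃₄ : ∀ {x y z u} → x ≡ T → z ≡ T → u ≡ T → Resolution x y z u
    three₁₃₄ p r s = swap₂₃ (three₁₂₄ p r s)

    three₂₃₄ : ∀ {x y z u} → y ≡ T → z ≡ T → u ≡ T → Resolution x y z u
    three₂₃₄ q r s = swap₁₂ (three₁₃₄ q r s)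

  resolution : ∀ x y z u → Regular ((x , y) ∷ (z , u) ∷ E) →
    τ (terminal b) (spokes two (x ∷ y ∷ z ∷ u ∷ []) ++ map (mapᵉ (punchIn two)) E) ≡
    τ T ((x , y) ∷ (z , u) ∷ E) + τ T ((x , z) ∷ (y , u) ∷ E) + τ T ((x , u) ∷ (y , z) ∷ E)
  resolution x y z u = cases (x ≟ T) (y ≟ T) (z ≟ T) (u ≟ T)
    where
    cases : Dec (x ≡ T) → Dec (y ≡ T) → Dec (z ≡ T) → Dec (u ≡ T) → Resolution x y z u
    cases (no p)  (no q)  (no r)  (no s)  = none p q r s
    cases (yes p) (no q)  (no r)  (no s)  = one₁ p q r s
    cases (no p)  (yes q) (no r)  (no s)  = one₂ p q r s
    cases (no p)  (no q)  (yes r) (no s)  = one₃ p q r s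
    cases (no p)  (no q)  (no r)  (yes s) = one₄ p q r s
    cases (yes p) (yes q) (no r)  (no s)  = two₁₂ p q r s
    cases (yes p) (no q)  (yes r) (no s)  = two₁₃ p q r s
    cases (yes p) (no q)  (no r)  (yes s) = two₁₄ p q r s
    cases (no p)  (yes q) (yes r) (no s)  = two₂₃ p q r s
    cases (no p)  (yes q) (no r)  (yes s) = two₂₄ p q r s
    cases (no p)  (no q)  (yes r) (yes s) = two₃₄ p q r s
    cases (yes p) (yes q) (yes r) _ = three₁₂₃ p q r
    cases (yes p) (yes q) (no r)  (yes s) = three₁₂₄ p q s
    cases (yes p) (no q)  (yes r) (yes s) = three₁₃₄ p r s
    cases (no p)  (yes q) (yes r) (yes s) = three₂₃₄ q r s

deg-punchIn : ∀ (x : Fin (2 + k)) q E → deg (punchIn x q) (map (mapᵉ (punchIn x)) E) ≡ deg q E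
deg-punchIn x q []            = refl
deg-punchIn x q ((a , b) ∷ E) = cong₂ _+_ (cong₂ (λ c d → bit c + bit d) (eq a) (eq b)) (deg-punchIn x q E)
  where
  eq : ∀ a → (punchIn x a == punchIn x q) ≡ (a == q)
  eq a = ==-injective (punchIn x) (punchIn-injective x _ _) a q

resolved-regular : ∀ (p : Fin (2 + k)) x y z u E →
  Regular (spokes p (x ∷ y ∷ z ∷ u ∷ []) ++ map (mapᵉ (punchIn p)) E) → Regular ((x , y) ∷ (z , u) ∷ E)
resolved-regular p x y z u E r q = trans (trans
  (rearrange (bit (x == q)) (bit (y == q)) (bit (z == q)) (bit (u == q)) (deg q E))
  (sym (cong₂ _+_ (eq x) (cong₂ _+_ (eq y) (cong₂ _+_ (eq z) (cong₂ _+_ (eq u) (deg-punchIn p q E)))))))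
  (r (punchIn p q))
  where
  eq : ∀ a → degᵉ (punchIn p q) (p , punchIn p a) ≡ bit (a == q)
  eq a = cong₂ (λ c d → bit c + bit d) (≢⇒== (punchInᵢ≢i p q ∘ sym)) (==-injective (punchIn p) (punchIn-injective p _ _) a q)
  rearrange : ∀ a b c d e → (a + b) + ((c + d) + e) ≡ a + (b + (c + (d + e)))
  rearrange = solve-∀

-- Exchanging the two terminals

τ-terminals : ∀ m (E : List (Edge (2 + m))) → Regular E → length E ≡ 4 + (m + m) → τ zero E ≡ τ (suc zero) E
τ-terminals zero E r l with star-at zero E
... | hasLoop E′ p = trans (zero-at zero) (sym (zero-at (suc zero)))
  where
  zero-at : ∀ z → τ z E ≡ 0
  zero-at z = trans (τ-≋ z p) (τ-loop z zero E′ (Regular-≋ p r) (trans (sym (≋-length p)) l))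
-- Away from vertex 0 only vertex 1 is left, so this edge is a loop at 1.
... | star ys ((zero , zero) ∷ E′) p _ = trans (zero-at zero) (sym (zero-at (suc zero)))
  where
  rest : List (Edge 2)
  rest = spokes zero ys ++ map (mapᵉ suc) E′
  p′ : E ≋ (suc zero , suc zero) ∷ rest
  p′ = ≋-trans p (≋-shift (suc zero , suc zero) (spokes zero ys) (map (mapᵉ suc) E′))
  zero-at : ∀ z → τ z E ≡ 0
  zero-at z = trans (τ-≋ z p′) (τ-loop z (suc zero) rest (Regular-≋ p′ r) (trans (sym (≋-length p′)) l))
-- Without loops every edge joins the two terminals and disappears with either of them.
... | star ys [] p _ = trans (τ-≋ zero p) (trans (cong (treePairs 0) (trans (all-hit zero ys) (sym (all-hit (suc zero) ys)))) (sym (τ-≋ (suc zero) p)))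
  where
  all-hit : ∀ (z : Fin 2) (ys : List (Fin 1)) → without z (spokes zero ys ++ []) ≡ []
  all-hit zero       []          = refl
  all-hit (suc zero) []          = refl
  all-hit zero       (zero ∷ ys) = all-hit zero ys
  all-hit (suc zero) (zero ∷ ys) = all-hit (suc zero) ys
τ-terminals (suc m) E r l with star-at two E
... | hasLoop E′ p = trans (zero-at zero) (sym (zero-at (suc zero)))
  where
  zero-at : ∀ z → τ z E ≡ 0
  zero-at z = trans (τ-≋ z p) (τ-loop z two E′ (Regular-≋ p r) (trans (sym (≋-length p)) l))
... | star ys E′ p l′ = four ys p (trans l′ (r two))
  where
  four : ∀ ys → E ≋ spokes two ys ++ map (mapᵉ (punchIn two)) E′ → length ys ≡ 4 → τ zero E ≡ τ (suc zero) E
  four (x ∷ y ∷ z ∷ u ∷ []) p refl = trans (expand zero) (trans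
    (cong₂ _+_ (cong₂ _+_ (τ-terminals m ((x , y) ∷ (z , u) ∷ E′) reg₁ size) (τ-terminals m ((x , z) ∷ (y , u) ∷ E′) reg₂ size))
               (τ-terminals m ((x , u) ∷ (y , z) ∷ E′) reg₃ size))
    (sym (expand (suc zero))))
    where
    size : 2 + length E′ ≡ 4 + (m + m)
    size = suc-injective (suc-injective (trans (cong (4 +_) (sym (length-map _ E′)))
      (trans (sym (≋-length p)) (trans l (cong (5 +_) (+-suc m m))))))
    reg₁ : Regular ((x , y) ∷ (z , u) ∷ E′)
    reg₁ = resolved-regular two x y z u E′ (Regular-≋ p r)
    reg₂ : Regular ((x , z) ∷ (y , u) ∷ E′)
    reg₂ = resolved-regular two x z y u E′ (Regular-≋ (≋-trans p (keep _ (exchange _ _ _))) r)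
    reg₃ : Regular ((x , u) ∷ (y , z) ∷ E′)
    reg₃ = resolved-regular two x u y z E′
      (Regular-≋ (≋-trans p (keep _ (≋-trans (keep _ (exchange _ _ _)) (exchange _ _ _)))) r)
    expand : ∀ b → τ (terminal b) E ≡ τ (terminal b) ((x , y) ∷ (z , u) ∷ E′) + τ (terminal b) ((x , z) ∷ (y , u) ∷ E′)
                                     + τ (terminal b) ((x , u) ∷ (y , z) ∷ E′)
    expand b = trans (τ-≋ (terminal b) p) (resolution b E′ size x y z u reg₁)

-- Breadth-first search

∨-true : ∀ a {b} → a ∨ b ≡ true → a ≡ true ⊎ b ≡ true
∨-true true  _  = inj₁ refl
∨-true false eq = inj₂ eq

∧-true : ∀ a {b} → a ∧ b ≡ true → a ≡ true × b ≡ true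
∧-true true eq = refl , eq

module _ {X : Set} (p : X → Bool) where

  any⇒∃ : ∀ xs → any p xs ≡ true → ∃ λ x → x ∈ xs × p x ≡ true
  any⇒∃ (x ∷ xs) eq with ∨-true (p x) eq
  ... | inj₁ px = x , here refl , px
  ... | inj₂ ps with any⇒∃ xs ps
  ...   | y , y∈ , py = y , there y∈ , py

  ∃⇒any : ∀ {xs x} → x ∈ xs → p x ≡ true → any p xs ≡ true
  ∃⇒any {x ∷ xs} (here refl) px = cong (_∨ any p xs) px
  ∃⇒any {x ∷ xs} (there x∈)  px = trans (cong (p x ∨_) (∃⇒any x∈ px)) (∨-zeroʳ (p x))

  all⇒∀ : ∀ {xs x} → all p xs ≡ true → x ∈ xs → p x ≡ true
  all⇒∀ {x ∷ xs} eq (here refl) = proj₁ (∧-true (p x) eq)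
  all⇒∀ {x ∷ xs} eq (there x∈)  = all⇒∀ (proj₂ (∧-true (p x) eq)) x∈

  ∀⇒all : ∀ xs → (∀ {x} → x ∈ xs → p x ≡ true) → all p xs ≡ true
  ∀⇒all []       h = refl
  ∀⇒all (x ∷ xs) h = cong₂ _∧_ (h (here refl)) (∀⇒all xs (h ∘ there))

  count : List X → ℕ
  count []       = 0
  count (x ∷ xs) = bit (p x) + count xs

  count≤length : ∀ xs → count xs ≤ length xs
  count≤length []       = z≤n
  count≤length (x ∷ xs) with p x
  ... | true  = s≤s (count≤length xs)
  ... | false = ≤-trans (count≤length xs) (n≤1+n _)

  0<count : ∀ {xs x} → x ∈ xs → p x ≡ true → 0 < count xs
  0<count {x ∷ xs} (here refl) px rewrite px = s≤s z≤n
  0<count {x ∷ xs} (there x∈)  px = ≤-trans (0<count x∈ px) (ℕ.m≤n+m _ (bit (p x)))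

module _ {X : Set} {p q : X → Bool} (p⇒q : ∀ x → p x ≡ true → q x ≡ true) where

  private
    bit-mono : ∀ x → bit (p x) ≤ bit (q x)
    bit-mono x with p x in eq
    ... | false = z≤n
    ... | true  rewrite p⇒q x eq = s≤s z≤n

  count-mono : ∀ xs → count p xs ≤ count q xs
  count-mono []       = z≤n
  count-mono (x ∷ xs) = ℕ.+-mono-≤ (bit-mono x) (count-mono xs)

  count-mono-< : ∀ {xs x} → x ∈ xs → q x ≡ true → p x ≡ false → count p xs < count q xs
  count-mono-< {x ∷ xs} (here refl) qx px rewrite qx | px = s≤s (count-mono xs)
  count-mono-< {x ∷ xs} (there x∈)  qx px = ℕ.+-mono-≤-< (bit-mono x) (count-mono-< x∈ qx px)

implies? : ∀ {X : Set} (p q : X → Bool) xs →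
  (∀ {x} → x ∈ xs → q x ≡ true → p x ≡ true) ⊎ (∃ λ x → x ∈ xs × q x ≡ true × p x ≡ false)
implies? p q [] = inj₁ λ ()
implies? p q (x ∷ xs) with implies? p q xs
... | inj₂ (y , y∈ , h) = inj₂ (y , there y∈ , h)
... | inj₁ h with q x in qx | p x in px
...   | true  | false = inj₂ (x , here refl , qx , px)
...   | false | _     = inj₁ λ { (here refl) qx′ → contradiction (trans (sym qx) qx′) λ () ; (there x∈) → h x∈ }
...   | true  | true  = inj₁ λ { (here refl) _ → px ; (there x∈) → h x∈ }

module _ (V : List (Fin n)) (A : List (Edge n)) where

  adjIn-potential : ∀ {s x y} → Potential s A → adjIn A x y ≡ true → s x ≡ s y
  adjIn-potential {s} {x} {y} h eq with any⇒∃ _ A eq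
  ... | (a , b) , e∈ , eq′ with ∨-true ((a == x) ∧ (b == y)) eq′
  ...   | inj₁ c with ∧-true (a == x) c
  ...     | p , q = trans (cong s (sym (==⇒≡ a x p))) (trans (All.lookup h e∈) (cong s (==⇒≡ b y q)))
  adjIn-potential {s} {x} {y} h eq | (a , b) , e∈ , eq′ | inj₂ c with ∧-true (a == y) c
  ...     | p , q = trans (cong s (sym (==⇒≡ b x q))) (trans (sym (All.lookup h e∈)) (cong s (==⇒≡ a y p)))

  reach-potential : ∀ {s} i {u y} → Potential s A → reach V A i u y ≡ true → s u ≡ s y
  reach-potential {s} zero    {u} {y} h eq = cong s (==⇒≡ u y eq)
  reach-potential {s} (suc i) {u} {y} h eq with ∨-true (reach V A i u y) eq
  ... | inj₁ r = reach-potential i h r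
  ... | inj₂ r with any⇒∃ _ V r
  ...   | x , _ , eq′ with ∧-true (reach V A i u x) eq′
  ...     | p , q = trans (reach-potential i h p) (adjIn-potential h q)

  connectedB⇒constant : connectedB V A ≡ true → ∀ {s u y} → Potential s A → u ∈ V → y ∈ V → s u ≡ s y
  connectedB⇒constant c h u∈ y∈ = reach-potential (length V) h (all⇒∀ _ (all⇒∀ _ c u∈) y∈)

  module _ {u : Fin n} (u∈V : u ∈ V) where

    private
      R : ℕ → Fin n → Bool
      R i = reach V A i u

      Stable : ℕ → Set
      Stable i = ∀ {y} → y ∈ V → R (suc i) y ≡ true → R i y ≡ true

      grow : ∀ i y → R i y ≡ true → R (suc i) y ≡ true
      grow i y r = cong (_∨ any (λ x → R i x ∧ adjIn A x y) V) r

      step : ∀ i {x y} → R i x ≡ true → x ∈ V → adjIn A x y ≡ true → R (suc i) y ≡ true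
      step i {x} {y} r x∈ e = trans (cong (R i y ∨_) (∃⇒any (λ x → R i x ∧ adjIn A x y) x∈ (cong₂ _∧_ r e))) (∨-zeroʳ (R i y))

      stable-suc : ∀ i → Stable i → Stable (suc i)
      stable-suc i st {y} y∈ r with ∨-true (R (suc i) y) r
      ... | inj₁ r′ = r′
      ... | inj₂ r′ with any⇒∃ (λ x → R (suc i) x ∧ adjIn A x y) V r′
      ...   | x , x∈ , eq with ∧-true (R (suc i) x) eq
      ...     | p , q = step i (st x∈ p) x∈ q

      -- As long as the reached set is not stable, every round gains a vertex of `V`, so its size
      -- outruns the number of rounds. For `length V` rounds this is impossible.
      stable-or-large : ∀ i → Stable i ⊎ i < count (R i) V
      stable-or-large zero = inj₂ (0<count (R 0) u∈V (==-refl u))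
      stable-or-large (suc i) with stable-or-large i
      ... | inj₁ st = inj₁ λ {y} → stable-suc i st {y}
      ... | inj₂ l with implies? (R i) (R (suc i)) V
      ...   | inj₁ st = inj₁ λ {y} → stable-suc i st {y}
      ...   | inj₂ (y , y∈ , p , q) = inj₂ (≤-trans (s≤s l) (count-mono-< (grow i) y∈ p q))

      stable : Stable (length V)
      stable with stable-or-large (length V)
      ... | inj₁ st = st
      ... | inj₂ l  = contradiction (≤-trans l (count≤length (R (length V)) V)) 1+n≰n

      reach-self : ∀ i → R i u ≡ true
      reach-self zero    = ==-refl u
      reach-self (suc i) = grow i u (reach-self i)

      adjIn-edge : ∀ {a b} → (a , b) ∈ A → adjIn A a b ≡ true × adjIn A b a ≡ true
      adjIn-edge {a} {b} e∈ =
          ∃⇒any _ e∈ (cong₂ (λ c d → (c ∧ d) ∨ ((a == b) ∧ (b == a))) (==-refl a) (==-refl b))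
        , ∃⇒any _ e∈ (trans (cong₂ (λ c d → ((a == b) ∧ (b == a)) ∨ (c ∧ d)) (==-refl a) (==-refl b)) (∨-zeroʳ _))

      -- Stability closes the reached set under edges, so its indicator is itself a colouring
      -- constant along them.
      potential : All (λ e → proj₁ e ∈ V × proj₂ e ∈ V) A → Potential (R (length V)) A
      potential h = All.tabulate λ {e} e∈ → let a∈ , b∈ = All.lookup h e∈; p , q = adjIn-edge e∈ in
        Bool-ext (λ r → stable b∈ (step (length V) r a∈ p)) (λ r → stable a∈ (step (length V) r b∈ q))

    constant⇒reach : All (λ e → proj₁ e ∈ V × proj₂ e ∈ V) A →
      (∀ {s u y} → Potential s A → u ∈ V → y ∈ V → s u ≡ s y) → ∀ {y} → y ∈ V → reach V A (length V) u y ≡ true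
    constant⇒reach h c y∈ = trans (sym (c (potential h) u∈V y∈)) (reach-self (length V))

  constant⇒connectedB : All (λ e → proj₁ e ∈ V × proj₂ e ∈ V) A →
    (∀ {s u y} → Potential s A → u ∈ V → y ∈ V → s u ≡ s y) → connectedB V A ≡ true
  constant⇒connectedB h c = ∀⇒all _ V λ u∈ → ∀⇒all _ V λ y∈ → constant⇒reach u∈ h c y∈

-- From sums of natural numbers to parities

sum-map-+ : ∀ {X : Set} (f g : X → ℕ) xs → sum (map (λ x → f x + g x) xs) ≡ sum (map f xs) + sum (map g xs)
sum-map-+ f g []       = refl
sum-map-+ f g (x ∷ xs) = trans (cong ((f x + g x) +_) (sum-map-+ f g xs)) (interchange (f x) (g x) _ _)

sum-map-concatMap : ∀ {X Y : Set} (f : Y → ℕ) (h : X → List Y) xs → sum (map f (concatMap h xs)) ≡ sum (map (λ x → sum (map f (h x))) xs)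
sum-map-concatMap f h []       = refl
sum-map-concatMap f h (x ∷ xs) = trans (cong sum (map-++ f (h x) _)) (trans (sum-++ (map f (h x)) _)
  (cong (sum (map f (h x)) +_) (sum-map-concatMap f h xs)))

sum-map-pairs : ∀ {X Y : Set} (f : Y → ℕ) (a b : X → Y) xs →
  sum (map f (concatMap (λ x → a x ∷ b x ∷ []) xs)) ≡ sum (map (f ∘ a) xs) + sum (map (f ∘ b) xs)
sum-map-pairs f a b xs = trans (sum-map-concatMap f _ xs)
  (trans (cong sum (map-cong (λ x → cong (f (a x) +_) (+-identityʳ (f (b x)))) xs)) (sum-map-+ (f ∘ a) (f ∘ b) xs))

does-≟true : ∀ b → does (b Bool.≟ true) ≡ b
does-≟true true  = refl
does-≟true false = refl

sum-map-filter : ∀ {X : Set} {P : X → Set} (P? : Decidable P) (f : X → ℕ) xs →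
  sum (map f (filter P? xs)) ≡ sum (map (λ x → bit (does (P? x)) * f x) xs)
sum-map-filter P? f [] = refl
sum-map-filter P? f (x ∷ xs) with does (P? x)
... | true  = cong₂ _+_ (sym (+-identityʳ (f x))) (sum-map-filter P? f xs)
... | false = sum-map-filter P? f xs

length-filter : ∀ {X : Set} {P : X → Set} (P? : Decidable P) xs → length (filter P? xs) ≡ sum (map (λ x → bit (does (P? x))) xs)
length-filter P? [] = refl
length-filter P? (x ∷ xs) with does (P? x)
... | true  = cong suc (length-filter P? xs)
... | false = length-filter P? xs

∑-points : ∀ k (F : List ℕ → ℕ) → sum (map F (points 2 k)) ≡ ∑ᵇ k (F ∘ map bit)
∑-points zero    F = +-identityʳ (F [])
∑-points (suc k) F = trans (sum-map-pairs F (0 ∷_) (1 ∷_) (points 2 k)) (cong₂ _+_ (∑-points k _) (∑-points k _))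

-- The size of the chosen set is a separate argument of `q`, since the spanning tree test counts the
-- marks of the mask; the induction over the edges shifts it by one for each chosen edge.
treeTerm : (q : ℕ → List (Edge n) → Bool) → List (Edge n) → List ℕ → List Bool → ℕ
treeTerm q E α T = if q (countTrue T) (select T E) then prodOutside T α else 0

odd-masks : ∀ (E : List (Edge n)) α q → length α ≡ length E →
  odd (sum (map (treeTerm q E (map bit α)) (masks (length E)))) ≡ S E α (λ A → q (length A) A)
odd-masks [] [] q l with q 0 []
... | true  = refl
... | false = refl
odd-masks (e ∷ E) (a ∷ α) q l = begin
  odd (sum (map F (masks (suc (length E)))))
    ≡⟨ cong odd (sum-map-pairs F (false ∷_) (true ∷_) (masks (length E))) ⟩
  odd (sum (map (F ∘ (false ∷_)) (masks (length E))) + sum (map (F ∘ (true ∷_)) (masks (length E))))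
    ≡⟨ odd-+ (sum (map (F ∘ (false ∷_)) (masks (length E)))) _ ⟩
  odd (sum (map (F ∘ (false ∷_)) (masks (length E)))) xor odd (sum (map (F ∘ (true ∷_)) (masks (length E))))
    ≡⟨ cong₂ _xor_ (outside a) (odd-masks E α (λ i A → q (suc i) (e ∷ A)) (suc-injective l)) ⟩
  (a ∧ S E α (λ A → q (length A) A)) xor S E α (λ A → q (suc (length A)) (e ∷ A))
    ≡⟨ xor-comm (a ∧ S E α (λ A → q (length A) A)) _ ⟩
  S E α (λ A → q (suc (length A)) (e ∷ A)) xor (a ∧ S E α (λ A → q (length A) A))
    ≡⟨ S-∷ e E a α (λ A → q (length A) A) ⟨
  S (e ∷ E) (a ∷ α) (λ A → q (length A) A) ∎
  where
  open ≡-Reasoning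
  F : List Bool → ℕ
  F = treeTerm q (e ∷ E) (map bit (a ∷ α))
  outside : ∀ a → odd (sum (map (treeTerm q (e ∷ E) (map bit (a ∷ α)) ∘ (false ∷_)) (masks (length E)))) ≡ a ∧ S E α (λ A → q (length A) A)
  outside true  = trans (cong (odd ∘ sum) (map-cong same (masks (length E)))) (odd-masks E α q (suc-injective l))
    where
    same : ∀ T → treeTerm q (e ∷ E) (1 ∷ map bit α) (false ∷ T) ≡ treeTerm q E (map bit α) T
    same T with q (countTrue T) (select T E)
    ... | true  = +-identityʳ _
    ... | false = refl
  outside false = cong odd (none (masks (length E)))
    where
    none : ∀ Ts → sum (map (treeTerm q (e ∷ E) (0 ∷ map bit α) ∘ (false ∷_)) Ts) ≡ 0
    none []       = refl
    none (T ∷ Ts) with q (countTrue T) (select T E)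
    ... | true  = none Ts
    ... | false = none Ts

does-%2 : ∀ x → does (x % 2 ℕ.≟ 0) ≡ not (odd x)
does-%2 x rewrite n%2≡bit x with odd x
... | true  = refl
... | false = refl

-- Serves to compare `spans` with `tree` on edges that avoid the deleted vertex.
S-cong-All : ∀ {P : Edge k → Set} (E : List (Edge k)) α {p q} → All P E → (∀ A → All P A → p A ≡ q A) → S E α p ≡ S E α q
S-cong-All []      α           []       eq = eq [] []
S-cong-All (e ∷ E) []          (h ∷ hs) eq = refl
S-cong-All (e ∷ E) (false ∷ α) (h ∷ hs) eq = S-cong-All E α hs λ A as → eq (e ∷ A) (h ∷ as)
S-cong-All (e ∷ E) (true ∷ α)  (h ∷ hs) eq = S-cong-All E α hs λ A as → cong₂ _xor_ (eq (e ∷ A) (h ∷ as)) (eq A as)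

spans : SubGraph n → List (Edge n) → Bool
spans H A = (length A ≡ᵇ (length (verts H) ∸ 1)) ∧ connectedB (verts H) A

zeroCount-S : ∀ (H : SubGraph n) → zeroCount 2 H ≡ ∑ᵇ (length (edges H)) (λ α → bit (not (S (edges H) α (spans H))))
zeroCount-S H = trans (length-filter _ (points 2 (length (edges H)))) (trans (∑-points (length (edges H)) _)
  (∑ᵇ-cong-length (length (edges H)) λ α l → cong bit (trans (does-%2 (Ψ H (map bit α))) (cong not
    (odd-masks (edges H) α (λ i A → (i ≡ᵇ (length (verts H) ∸ 1)) ∧ connectedB (verts H) A) l)))))

-- Sums over vertices and edge counts

∑ : (Fin n → ℕ) → ℕ
∑ {zero}  h = 0
∑ {suc n} h = h zero + ∑ (h ∘ suc)

∑-cong : {g h : Fin n → ℕ} → (∀ i → g i ≡ h i) → ∑ g ≡ ∑ h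
∑-cong {zero}  eq = refl
∑-cong {suc n} eq = cong₂ _+_ (eq zero) (∑-cong (eq ∘ suc))

∑-+ : (g h : Fin n → ℕ) → ∑ (λ i → g i + h i) ≡ ∑ g + ∑ h
∑-+ {zero}  g h = refl
∑-+ {suc n} g h = trans (cong ((g zero + h zero) +_) (∑-+ (g ∘ suc) (h ∘ suc))) (interchange (g zero) (h zero) _ _)

∑-*ʳ : (h : Fin n → ℕ) → ∀ c → ∑ (λ i → h i * c) ≡ ∑ h * c
∑-*ʳ {zero}  h c = refl
∑-*ʳ {suc n} h c = trans (cong (h zero * c +_) (∑-*ʳ (h ∘ suc) c)) (sym (*-distribʳ-+ c (h zero) _))

∑-const : ∀ n c → ∑ {n} (λ _ → c) ≡ n * c
∑-const zero    c = refl
∑-const (suc n) c = cong (c +_) (∑-const n c)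

∑-δ : ∀ (h : Fin n → ℕ) z → ∑ (λ i → h i * bit (i == z)) ≡ h z
∑-δ {suc n} h zero    = trans (cong₂ _+_ (*-identityʳ (h zero)) (trans (∑-cong λ i → *-zeroʳ (h (suc i))) (trans (∑-const n 0) (*-zeroʳ n)))) (+-identityʳ (h zero))
∑-δ {suc n} h (suc z) = cong₂ _+_ (*-zeroʳ (h zero)) (trans
  (∑-cong λ i → cong (λ b → h (suc i) * bit b) (==-injective suc Fin.suc-injective i z)) (∑-δ (h ∘ suc) z))

∑-bit : ∀ (z : Fin n) → ∑ (λ i → bit (i == z)) ≡ 1
∑-bit z = trans (∑-cong λ i → sym (*-identityˡ (bit (i == z)))) (∑-δ (λ _ → 1) z)

sum-allFin : ∀ (h : Fin n → ℕ) → sum (map h (allFin n)) ≡ ∑ h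
sum-allFin h = trans (cong sum (map-tabulate id h)) (sum-tabulate h)
  where
  sum-tabulate : ∀ {n} (h : Fin n → ℕ) → sum (tabulate h) ≡ ∑ h
  sum-tabulate {zero}  h = refl
  sum-tabulate {suc n} h = cong (h zero +_) (sum-tabulate (h ∘ suc))

handshake : ∀ (E : List (Edge n)) → ∑ (λ z → deg z E) ≡ length E * 2
handshake {n} [] = trans (∑-const n 0) (*-zeroʳ n)
handshake ((x , y) ∷ E) = trans (∑-+ (λ z → degᵉ z (x , y)) (λ z → deg z E)) (cong₂ _+_
  (trans (∑-+ (λ z → bit (x == z)) (λ z → bit (y == z))) (cong₂ _+_ (one x) (one y))) (handshake E))
  where
  one : ∀ x → ∑ (λ z → bit (x == z)) ≡ 1
  one x = trans (∑-cong λ z → cong bit (==-sym x z)) (∑-bit x)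

NoLoops : List (Edge k) → Set
NoLoops = All (λ e → proj₁ e ≢ proj₂ e)

length-without-≡ : ∀ (z : Fin (2 + m)) {E} → NoLoops E → length (without z E) + deg z E ≡ length E
length-without-≡ z [] = refl
length-without-≡ z {(x , y) ∷ E} (ne ∷ h) with x ≟ z | y ≟ z
... | yes refl | yes refl = contradiction refl ne
... | yes _    | no  _    = trans (+-suc (length (without z E)) (deg z E)) (cong suc (length-without-≡ z h))
... | no  _    | yes _    = trans (+-suc (length (without z E)) (deg z E)) (cong suc (length-without-≡ z h))
... | no  _    | no  _    = cong suc (length-without-≡ z h)

punchIn-side : ∀ b {x : Fin (2 + m)} → x ≢ terminal b → punchIn (terminal b) (side x) ≡ x
punchIn-side zero    {zero}        ne = contradiction refl ne
punchIn-side zero    {suc x}       ne = refl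
punchIn-side (suc _) {zero}        ne = refl
punchIn-side (suc _) {suc zero}    ne = contradiction refl ne
punchIn-side (suc _) {suc (suc x)} ne = refl

side-punchIn-terminal : ∀ b (x : Fin (1 + m)) → side (punchIn (terminal b) x) ≡ x
side-punchIn-terminal zero    x       = refl
side-punchIn-terminal (suc _) zero    = refl
side-punchIn-terminal (suc _) (suc x) = refl

touches-false : ∀ {z x y : Fin k} → touches z (x , y) ≡ false → x ≢ z × y ≢ z
touches-false {z = z} {x} {y} eq =
    (λ { refl → contradiction (trans (sym (==-refl z)) (∨-conicalˡ (x == z) (y == z) eq)) λ () })
  , (λ { refl → contradiction (trans (sym (==-refl z)) (∨-conicalʳ (x == z) (y == z) eq)) λ () })

without-noLoops : ∀ b {E : List (Edge (2 + m))} → NoLoops E → NoLoops (without (terminal b) E)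
without-noLoops b [] = []
without-noLoops b {(x , y) ∷ E} (ne ∷ h) with touches (terminal b) (x , y) in eq
... | true  = without-noLoops b h
... | false = (λ s≡s → ne (trans (sym (punchIn-side b (proj₁ (touches-false eq))))
                  (trans (cong (punchIn (terminal b)) s≡s) (punchIn-side b (proj₂ (touches-false eq))))))
              ∷ without-noLoops b h

joinsᵉ : Fin k → Fin k → Edge k → ℕ
joinsᵉ a b (x , y) = bit ((x == a) ∧ (y == b)) + bit ((x == b) ∧ (y == a))

joins : Fin k → Fin k → List (Edge k) → ℕ
joins a b E = sum (map (joinsᵉ a b) E)

-- Vertex 1 receives the number 0 when vertex 0 is deleted, and it loses exactly its edges to vertex
-- 0.
deg-without-0 : ∀ (E : List (Edge (2 + m))) → deg zero (without zero E) + joins zero (suc zero) E ≡ deg (suc zero) E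
deg-without-0 [] = refl
deg-without-0 ((zero , zero) ∷ E) = deg-without-0 E
deg-without-0 ((zero , suc zero) ∷ E) = trans (+-suc (deg zero (without zero E)) _) (cong suc (deg-without-0 E))
deg-without-0 ((zero , suc (suc y)) ∷ E) = deg-without-0 E
deg-without-0 ((suc zero , zero) ∷ E) = trans (+-suc (deg zero (without zero E)) _) (cong suc (deg-without-0 E))
deg-without-0 ((suc zero , suc zero) ∷ E) = cong (2 +_) (deg-without-0 E)
deg-without-0 ((suc zero , suc (suc y)) ∷ E) = cong suc (deg-without-0 E)
deg-without-0 ((suc (suc x) , zero) ∷ E) = deg-without-0 E
deg-without-0 ((suc (suc x) , suc zero) ∷ E) = cong suc (deg-without-0 E)
deg-without-0 ((suc (suc x) , suc (suc y)) ∷ E) = deg-without-0 E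

deg-without-1 : ∀ (E : List (Edge (2 + m))) → deg zero (without (suc zero) E) + joins zero (suc zero) E ≡ deg zero E
deg-without-1 [] = refl
deg-without-1 ((zero , zero) ∷ E) = cong (2 +_) (deg-without-1 E)
deg-without-1 ((zero , suc zero) ∷ E) = trans (+-suc (deg zero (without (suc zero) E)) _) (cong suc (deg-without-1 E))
deg-without-1 ((zero , suc (suc y)) ∷ E) = cong suc (deg-without-1 E)
deg-without-1 ((suc zero , zero) ∷ E) = trans (+-suc (deg zero (without (suc zero) E)) _) (cong suc (deg-without-1 E))
deg-without-1 ((suc zero , suc zero) ∷ E) = deg-without-1 E
deg-without-1 ((suc zero , suc (suc y)) ∷ E) = deg-without-1 E
deg-without-1 ((suc (suc x) , zero) ∷ E) = cong suc (deg-without-1 E)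
deg-without-1 ((suc (suc x) , suc zero) ∷ E) = deg-without-1 E
deg-without-1 ((suc (suc x) , suc (suc y)) ∷ E) = deg-without-1 E

-- The single edge between the terminals leaves the remaining one with degree 3, the situation of
-- `zeros-treePairs`; deleting four of the `4 + 2m` edges leaves the number needed for two spanning
-- trees.
zeros-τ : ∀ b (E : List (Edge (2 + m))) → 3 ≤ m → NoLoops E → Regular E → length E ≡ 4 + (m + m) → joins zero (suc zero) E ≡ 1 →
  zeros m (without (terminal b) E) / 4 % 2 ≡ τ (terminal b) E / 4 % 2
zeros-τ {suc k} b E (s≤s 2≤k) noLoops regular size one with star-at zero (without (terminal b) E)
... | hasLoop E′ p = ⊥-elim (All.head (All-≋ (λ ne → ne ∘ sym) p (without-noLoops b noLoops)) refl)
... | star ys K p l = three ys p (trans l (deg≡3 b))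
  where
  deg≡3 : ∀ b → deg zero (without (terminal b) E) ≡ 3
  deg≡3 zero    = suc-injective (trans (+-comm 1 _) (trans (cong (deg zero (without zero E) +_) (sym one)) (trans (deg-without-0 E) (regular (suc zero)))))
  deg≡3 (suc _) = suc-injective (trans (+-comm 1 _) (trans (cong (deg zero (without (suc zero) E) +_) (sym one)) (trans (deg-without-1 E) (regular zero))))
  W : List (Edge (2 + k))
  W = without (terminal b) E
  length-W : length W ≡ suc k + suc k
  length-W = ℕ.+-cancelʳ-≡ 4 (length W) (suc k + suc k) (trans (trans (cong (length W +_) (sym (regular (terminal b)))) (length-without-≡ (terminal b) noLoops))
    (trans size (+-comm 4 (suc k + suc k))))
  three : ∀ ys → W ≋ spokes zero ys ++ map (mapᵉ (punchIn zero)) K → length ys ≡ 3 → zeros (suc k) W / 4 % 2 ≡ treePairs (suc k) W / 4 % 2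
  three (x ∷ y ∷ z ∷ []) p refl = trans (cong (λ n → n / 4 % 2) (zeros-≋ (suc k) p)) (trans
    (zeros-treePairs k K x y z 2≤k (suc-injective (suc-injective (trans (cong (3 +_) (sym (length-map _ K)))
      (trans (sym (≋-length p)) (trans length-W (cong suc (+-suc k k))))))))
    (cong (λ n → n / 4 % 2) (sym (treePairs-≋ (suc k) p))))

-- Degrees in the edge list of a graph

<⇒<ᵇ≡true : ∀ {a b} → a < b → (a <ᵇ b) ≡ true
<⇒<ᵇ≡true p = Equivalence.to T-≡ (<⇒<ᵇ p)

≮⇒<ᵇ≡false : ∀ {a b} → ¬ (a < b) → (a <ᵇ b) ≡ false
≮⇒<ᵇ≡false {a} {b} p with a <ᵇ b in eq
... | true  = contradiction (<ᵇ⇒< a b (Equivalence.from T-≡ eq)) p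
... | false = refl

module _ (G : Graph n) where

  private
    c : Fin n → Fin n → ℕ
    c x y = bit ((toℕ x <ᵇ toℕ y) ∧ adj G x y)

  sum-edgesOf : ∀ φ → sum (map φ (edgesOf G)) ≡ ∑ (λ x → ∑ (λ y → c x y * φ (x , y)))
  sum-edgesOf φ = trans (sum-map-filter _ φ (concatMap (λ i → map (λ j → (i , j)) (allFin n)) (allFin n)))
    (trans (sum-map-concatMap φ′ (λ i → map (λ j → (i , j)) (allFin n)) (allFin n))
    (trans (sum-allFin (λ x → sum (map φ′ (map (λ y → (x , y)) (allFin n)))))
    (∑-cong λ x → trans (cong sum (sym (map-∘ (allFin n)))) (trans (sum-allFin (λ y → φ′ (x , y)))
      (∑-cong λ y → cong (λ b → bit b * φ (x , y)) (does-≟true ((toℕ x <ᵇ toℕ y) ∧ adj G x y)))))))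
    where
    φ′ : Edge n → ℕ
    φ′ (x , y) = bit (does ((toℕ x <ᵇ toℕ y) ∧ adj G x y Bool.≟ true)) * φ (x , y)

  -- `edgesOf` lists an edge only from its smaller to its larger end, so exactly one orientation of
  -- each edge is counted.
  c-+ : ∀ x y → c x y + c y x ≡ bit (adj G x y)
  c-+ x y with <-cmp x y
  ... | tri< x<y _ y≮x rewrite Graph.sym G y x | <⇒<ᵇ≡true x<y | ≮⇒<ᵇ≡false y≮x = +-identityʳ _
  ... | tri> x≮y _ y<x rewrite Graph.sym G y x | <⇒<ᵇ≡true y<x | ≮⇒<ᵇ≡false x≮y = refl
  ... | tri≈ _ refl _ rewrite irrefl G x | ∧-zeroʳ (toℕ x <ᵇ toℕ x) = refl

  deg-edgesOf : ∀ z → deg z (edgesOf G) ≡ degree G z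
  deg-edgesOf z = begin
    deg z (edgesOf G)                                              ≡⟨ deg-sum (edgesOf G) ⟩
    sum (map (degᵉ z) (edgesOf G))                                 ≡⟨ sum-edgesOf (degᵉ z) ⟩
    ∑ (λ x → ∑ (λ y → c x y * (bit (x == z) + bit (y == z))))
      ≡⟨ ∑-cong (λ x → trans (∑-cong λ y → *-distribˡ-+ (c x y) (bit (x == z)) (bit (y == z))) (trans (∑-+ (λ y → c x y * bit (x == z)) _)
           (cong₂ _+_ (∑-*ʳ (c x) (bit (x == z))) (∑-δ (c x) z)))) ⟩
    ∑ (λ x → ∑ (c x) * bit (x == z) + c x z)                       ≡⟨ ∑-+ (λ x → ∑ (c x) * bit (x == z)) _ ⟩
    ∑ (λ x → ∑ (c x) * bit (x == z)) + ∑ (λ x → c x z)             ≡⟨ cong (_+ ∑ (λ x → c x z)) (∑-δ (λ x → ∑ (c x)) z) ⟩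
    ∑ (c z) + ∑ (λ x → c x z)                                      ≡⟨ ∑-+ (c z) (λ x → c x z) ⟨
    ∑ (λ x → c z x + c x z)                                        ≡⟨ ∑-cong (c-+ z) ⟩
    ∑ (λ x → bit (adj G z x))                                      ≡⟨ ∑-cong (λ x → cong bit (does-≟true (adj G z x))) ⟨
    ∑ (λ x → bit (does (adj G z x Bool.≟ true)))                   ≡⟨ sum-allFin (λ x → bit (does (adj G z x Bool.≟ true))) ⟨
    sum (map (λ x → bit (does (adj G z x Bool.≟ true))) (allFin n)) ≡⟨ length-filter (λ x → adj G z x Bool.≟ true) (allFin n) ⟨
    degree G z                                                     ∎
    where
    open ≡-Reasoning
    deg-sum : ∀ E → deg z E ≡ sum (map (degᵉ z) E)
    deg-sum []      = refl
    deg-sum (e ∷ E) = cong (degᵉ z e +_) (deg-sum E)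

  joins-edgesOf : ∀ a b → joins a b (edgesOf G) ≡ bit (adj G a b)
  joins-edgesOf a b = begin
    joins a b (edgesOf G)                     ≡⟨ sum-edgesOf (joinsᵉ a b) ⟩
    ∑ (λ x → ∑ (λ y → c x y * joinsᵉ a b (x , y)))
      ≡⟨ ∑-cong (λ x → trans (∑-cong λ y → *-distribˡ-+ (c x y) (bit ((x == a) ∧ (y == b))) _) (trans (∑-+ (λ y → c x y * bit ((x == a) ∧ (y == b))) _)
           (cong₂ _+_ (pick x a b) (pick x b a)))) ⟩
    ∑ (λ x → c x b * bit (x == a) + c x a * bit (x == b)) ≡⟨ ∑-+ (λ x → c x b * bit (x == a)) _ ⟩
    _                                         ≡⟨ cong₂ _+_ (∑-δ (λ x → c x b) a) (∑-δ (λ x → c x a) b) ⟩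
    c a b + c b a                             ≡⟨ c-+ a b ⟩
    bit (adj G a b)                           ∎
    where
    open ≡-Reasoning
    pick : ∀ x a b → ∑ (λ y → c x y * bit ((x == a) ∧ (y == b))) ≡ c x b * bit (x == a)
    pick x a b = trans (∑-cong λ y → trans (cong (c x y *_) (trans (bit-∧ (x == a) (y == b)) (*-comm (bit (x == a)) _))) (sym (*-assoc (c x y) _ _)))
      (trans (∑-*ʳ (λ y → c x y * bit (y == b)) (bit (x == a))) (cong (_* bit (x == a)) (∑-δ (c x) b)))

  noLoops-edgesOf : NoLoops (edgesOf G)
  noLoops-edgesOf = All.map loopless (all-filter (λ e → ((toℕ (proj₁ e) <ᵇ toℕ (proj₂ e)) ∧ adj G (proj₁ e) (proj₂ e)) Bool.≟ true)
    (concatMap (λ i → map (λ j → (i , j)) (allFin n)) (allFin n)))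
    where
    loopless : ∀ {e} → ((toℕ (proj₁ e) <ᵇ toℕ (proj₂ e)) ∧ adj G (proj₁ e) (proj₂ e)) ≡ true → proj₁ e ≢ proj₂ e
    loopless {x , y} h refl = contradiction (trans (sym h) (cong (_∧ adj G x x) (≮⇒<ᵇ≡false (1+n≰n {toℕ x})))) λ ()

-- Renumbering so that the two given vertices become terminals

module _ (f : Fin j → Fin k) (f-injective : ∀ {x y} → f x ≡ f y → x ≡ y) where

  deg-map : ∀ z E → deg (f z) (map (mapᵉ f) E) ≡ deg z E
  deg-map z []            = refl
  deg-map z ((x , y) ∷ E) = cong₂ _+_
    (cong₂ (λ a b → bit a + bit b) (==-injective f f-injective x z) (==-injective f f-injective y z)) (deg-map z E)

  joins-map : ∀ a b E → joins (f a) (f b) (map (mapᵉ f) E) ≡ joins a b E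
  joins-map a b []            = refl
  joins-map a b ((x , y) ∷ E) = cong₂ _+_ (cong₂ _+_
    (cong₂ (λ p q → bit (p ∧ q)) (==-injective f f-injective x a) (==-injective f f-injective y b))
    (cong₂ (λ p q → bit (p ∧ q)) (==-injective f f-injective x b) (==-injective f f-injective y a))) (joins-map a b E)

  noLoops-map : ∀ {E} → NoLoops E → NoLoops (map (mapᵉ f) E)
  noLoops-map h = map⁺ (All.map (λ ne → ne ∘ f-injective) h)

module _ (G : Graph (2 + m)) (π : Permutation′ (2 + m)) where

  relabelled : List (Edge (2 + m))
  relabelled = map (mapᵉ (π ⟨$⟩ʳ_)) (edgesOf G)

  private
    f g : Fin (2 + m) → Fin (2 + m)
    f = π ⟨$⟩ʳ_
    g = π ⟨$⟩ˡ_

  ⟨$⟩ʳ-injective : ∀ {x y} → π ⟨$⟩ʳ x ≡ π ⟨$⟩ʳ y → x ≡ y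
  ⟨$⟩ʳ-injective eq = trans (sym (inverseˡ π)) (trans (cong g eq) (inverseˡ π))

  module _ (b : Fin 2) (d : Fin (2 + m)) (fd : π ⟨$⟩ʳ d ≡ terminal b) where

    private
      H : SubGraph (2 + m)
      H = delete G d

      V : List (Fin (2 + m))
      V = verts H

      Avoids : Edge (2 + m) → Set
      Avoids e = proj₁ e ≢ d × proj₂ e ≢ d

      ∈V : ∀ {u} → u ≢ d → u ∈ V
      ∈V {u} ne = ∈-filter⁺ (λ u → not (u == d) Bool.≟ true) (∈-allFin u) (cong not (≢⇒== ne))

      V≢ : ∀ {u} → u ∈ V → u ≢ d
      V≢ {u} u∈ refl = contradiction (trans (sym (cong not (==-refl u))) (proj₂ (∈-filter⁻ (λ u → not (u == d) Bool.≟ true) {xs = allFin (2 + m)} u∈))) λ ()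

      length-V : length V ≡ suc m
      length-V = suc-injective (trans (+-comm 1 (length V)) (trans
        (cong₂ _+_ (trans (length-filter (λ u → not (u == d) Bool.≟ true) (allFin (2 + m))) (sum-allFin (λ u → bit (does (not (u == d) Bool.≟ true))))) (sym (∑-bit d)))
        (trans (sym (∑-+ (λ u → bit (does (not (u == d) Bool.≟ true))) (λ u → bit (u == d))))
        (trans (∑-cong λ u → complement (u == d)) (trans (∑-const (2 + m) 1) (*-identityʳ (2 + m)))))))
        where
        complement : ∀ c → bit (does (not c Bool.≟ true)) + bit c ≡ 1
        complement true  = refl
        complement false = refl

      ρ : Fin (2 + m) → Fin (1 + m)
      ρ = side ∘ f

      ι : Fin (1 + m) → Fin (2 + m)
      ι p = g (punchIn (terminal b) p)

      ρ-ι : ∀ p → ρ (ι p) ≡ p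
      ρ-ι p = trans (cong side (inverseʳ π)) (side-punchIn-terminal b p)

      ι-ρ : ∀ {a} → a ≢ d → ι (ρ a) ≡ a
      ι-ρ {a} ne = trans (cong g (punchIn-side b λ eq → ne (⟨$⟩ʳ-injective (trans eq (sym fd))))) (inverseˡ π)

      ι≢d : ∀ p → ι p ≢ d
      ι≢d p eq = punchInᵢ≢i (terminal b) p (trans (sym (inverseʳ π)) (trans (cong f eq) fd))

      constant⇒Conn : ∀ {A} → (∀ {s u y} → Potential s A → u ∈ V → y ∈ V → s u ≡ s y) → Conn (map (mapᵉ ρ) A)
      constant⇒Conn c s h p q = trans (cong s (sym (ρ-ι p))) (trans
        (c {s ∘ ρ} (map⁻ h) (∈V (ι≢d p)) (∈V (ι≢d q))) (cong s (ρ-ι q)))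

      Conn⇒constant : ∀ {A} → All Avoids A → Conn (map (mapᵉ ρ) A) → ∀ {s u y} → Potential s A → u ∈ V → y ∈ V → s u ≡ s y
      Conn⇒constant {A} avoid c {s} {u} {y} h u∈ y∈ = trans (cong s (sym (ι-ρ (V≢ u∈)))) (trans
        (c (s ∘ ι) (map⁺ (All.zipWith transfer (avoid , h))) (ρ u) (ρ y)) (cong s (ι-ρ (V≢ y∈))))
        where
        transfer : ∀ {e} → Avoids e × s (proj₁ e) ≡ s (proj₂ e) → s (ι (ρ (proj₁ e))) ≡ s (ι (ρ (proj₂ e)))
        transfer ((a≢ , b≢) , eq) = trans (cong s (ι-ρ a≢)) (trans eq (cong s (sym (ι-ρ b≢))))

      -- Both tests amount to the right number of edges and connectedness in terms of colourings.
      -- These are carried over by `ρ` and `ι`, inverse bijections between the vertices other than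
      -- `d` and `Fin (1 + m)`.
      spans-tree : ∀ A → All Avoids A → spans H A ≡ tree m (map (mapᵉ ρ) A)
      spans-tree A avoid = Bool-ext to from
        where
        to : spans H A ≡ true → tree m (map (mapᵉ ρ) A) ≡ true
        to eq with ∧-true (length A ≡ᵇ (length V ∸ 1)) eq
        ... | l , c = Conn⇒tree m (map (mapᵉ ρ) A)
          (trans (length-map (mapᵉ ρ) A) (trans (≡ᵇ⇒≡ (length A) _ (Equivalence.from T-≡ l)) (cong (_∸ 1) length-V)))
          (constant⇒Conn (connectedB⇒constant V A c))
        from : tree m (map (mapᵉ ρ) A) ≡ true → spans H A ≡ true
        from t = cong₂ _∧_
          (Equivalence.to T-≡ (≡⇒≡ᵇ (length A) (length V ∸ 1)
            (trans (sym (length-map (mapᵉ ρ) A)) (trans (tree⇒length m _ t) (cong (_∸ 1) (sym length-V))))))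
          (constant⇒connectedB V A (All.map (λ (a≢ , b≢) → ∈V a≢ , ∈V b≢) avoid)
            (Conn⇒constant avoid (tree⇒Conn m _ t)))

      edges-avoid : All Avoids (edges H)
      edges-avoid = All.map avoids (all-filter (λ e → not (touches d e) Bool.≟ true) (edgesOf G))
        where
        avoids : ∀ {e} → not (touches d e) ≡ true → Avoids e
        avoids {x , y} eq with touches d (x , y) in t
        ... | false = touches-false t

      relabel-edges : map (mapᵉ ρ) (edges H) ≡ without (terminal b) relabelled
      relabel-edges = go (edgesOf G)
        where
        at : ∀ x → (f x == terminal b) ≡ (x == d)
        at x = trans (cong (f x ==_) (sym fd)) (==-injective f ⟨$⟩ʳ-injective x d)
        go : ∀ E → map (mapᵉ ρ) (filter (λ e → not (touches d e) Bool.≟ true) E) ≡ without (terminal b) (map (mapᵉ f) E)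
        go []            = refl
        go ((x , y) ∷ E) rewrite at x | at y with (x == d) ∨ (y == d)
        ... | true  = go E
        ... | false = cong ((ρ x , ρ y) ∷_) (go E)

    zeroCount-zeros : zeroCount 2 (delete G d) ≡ zeros m (without (terminal b) relabelled)
    zeroCount-zeros = trans (zeroCount-S H) (trans
      (∑ᵇ-cong (length (edges H)) λ α → cong (bit ∘ not) (trans
        (S-cong-All (edges H) α edges-avoid spans-tree) (sym (S-map (mapᵉ ρ) (edges H) α (tree m)))))
      (trans (cong (λ l → ∑ᵇ l (λ α → bit (not (S (map (mapᵉ ρ) (edges H)) α (tree m))))) (sym (length-map (mapᵉ ρ) (edges H))))
        (cong (zeros m) relabel-edges)))

  module _ (regular : FourRegular G) (v w : Fin (2 + m)) (π-v : π ⟨$⟩ʳ v ≡ zero) (π-w : π ⟨$⟩ʳ w ≡ suc zero) (v~w : adj G v w ≡ true) where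

    private
      E-regular : Regular relabelled
      E-regular z = trans (cong (λ x → deg x relabelled) (sym (inverseʳ π))) (trans
        (deg-map f ⟨$⟩ʳ-injective (g z) (edgesOf G)) (trans (deg-edgesOf G (g z)) (regular (g z))))

      E-size : length relabelled ≡ 4 + (m + m)
      E-size = ℕ.*-cancelʳ-≡ (length relabelled) (4 + (m + m)) 2 (trans (sym (handshake relabelled))
        (trans (∑-cong E-regular) (trans (∑-const (2 + m) 4) (arithmetic m))))
        where
        arithmetic : ∀ m → (2 + m) * 4 ≡ (4 + (m + m)) * 2
        arithmetic = solve-∀

      E-joins : joins zero (suc zero) relabelled ≡ 1
      E-joins = trans (cong₂ (λ a b → joins a b relabelled) (sym π-v) (sym π-w))
        (trans (joins-map f ⟨$⟩ʳ-injective v w (edgesOf G)) (trans (joins-edgesOf G v w) (cong bit v~w)))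

      3≤m : 3 ≤ m
      -- `v` and its four neighbours are five distinct vertices: filtering all vertices by adjacency
      -- to `v` drops at least `v` itself.
      3≤m = ℕ.≤-pred (ℕ.≤-pred (≤-trans (s≤s (≤-reflexive (sym (regular v)))) (≤-trans
        (filter-notAll (λ j → adj G v j Bool.≟ true) (allFin (2 + m)) (lose (∈-allFin v) λ v~v → contradiction (trans (sym v~v) (irrefl G v)) λ ()))
        (≤-reflexive (length-tabulate id)))))

      c2-τ : ∀ b d → π ⟨$⟩ʳ d ≡ terminal b → c2 2 (delete G d) ≡ τ (terminal b) relabelled / 4 % 2
      c2-τ b d πd = trans (cong (λ n → n / 4 % 2) (zeroCount-zeros b d πd))
        (zeros-τ b relabelled 3≤m (noLoops-map f ⟨$⟩ʳ-injective (noLoops-edgesOf G)) E-regular E-size E-joins)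

    c2-delete : c2 2 (delete G v) ≡ c2 2 (delete G w)
    c2-delete = trans (c2-τ zero v π-v) (trans
      (cong (λ n → n / 4 % 2) (τ-terminals m relabelled E-regular E-size)) (sym (c2-τ (suc zero) w π-w)))

module _ {v w : Fin (2 + m)} (v≢w : v ≢ w) where

  private
    transpose-source : ∀ (x y : Fin (2 + m)) → transpose x y ⟨$⟩ʳ x ≡ y
    transpose-source x y with x ≟ x
    ... | yes _ = refl
    ... | no ne = contradiction refl ne

    transpose-fixes : ∀ (x y z : Fin (2 + m)) → z ≢ x → z ≢ y → transpose x y ⟨$⟩ʳ z ≡ z
    transpose-fixes x y z z≢x z≢y with z ≟ x
    ... | yes eq = contradiction eq z≢x
    ... | no _ with z ≟ y
    ...   | yes eq = contradiction eq z≢y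
    ...   | no _   = refl

    σ : Permutation′ (2 + m)
    σ = transpose v zero

  -- First `v` is moved to 0. The second transposition moves the image of `w` to 1 and fixes 0,
  -- because that image is not 0.
  toTerminals : Permutation′ (2 + m)
  toTerminals = σ ∘ₚ transpose (σ ⟨$⟩ʳ w) (suc zero)

  toTerminals-v : toTerminals ⟨$⟩ʳ v ≡ zero
  toTerminals-v = trans (cong (transpose (σ ⟨$⟩ʳ w) (suc zero) ⟨$⟩ʳ_) (transpose-source v zero))
    (transpose-fixes (σ ⟨$⟩ʳ w) (suc zero) zero (λ eq → v≢w (trans (sym (inverseˡ σ)) (trans (cong (σ ⟨$⟩ˡ_) (trans (transpose-source v zero) eq)) (inverseˡ σ)))) λ ())

  toTerminals-w : toTerminals ⟨$⟩ʳ w ≡ suc zero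
  toTerminals-w = transpose-source (σ ⟨$⟩ʳ w) (suc zero)

theorem5p10 : ∀ {n : ℕ} (G : Graph n) → Connected G → FourRegular G →
    (v w : Fin n) → adj G v w ≡ true →
    (∀ x → ¬ (adj G v x ≡ true × adj G w x ≡ true)) →
    c2 2 (delete G v) ≡ c2 2 (delete G w)
-- On a single vertex `v` and `w` coincide.
theorem5p10 {suc zero} G _ _ zero zero v~w _ = refl
theorem5p10 {suc (suc m)} G _ regular v w v~w _ =
  c2-delete G (toTerminals v≢w) regular v w (toTerminals-v v≢w) (toTerminals-w v≢w) v~w
  where
  v≢w : v ≢ w
  v≢w refl = contradiction (trans (sym v~w) (irrefl G v)) λ ()
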